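{- Let $p$ be an odd prime, $h\ge 1$, $f(x,z)\in\mathbb{F}_{p^h}[x,z]$, and let $\mathcal{S}\subset\mathbb{A}^3$ be the affine surface $y^p-y=f(x,z)$. For each $\gamma\in\mathbb{F}_{p^h}$ with $f(x,\gamma)$ non-constant, let $\mathcal{Z}_\gamma=V(y^p-y-f(x,z),\,z-\gamma)$, viewed as a plane curve $y^p-y=f(x,\gamma)$ in the plane $z=\gamma$. Let $\eta$ be a positive integer and $$\Gamma=\{\gamma\in\mathbb{F}_{p^h}: f(x,\gamma)\text{ non-constant and } \#\pi_x(\mathcal{Z}_\gamma(\mathbb{F}_{p^h}))\ge\eta\}.$$ Assume there are non-negative integers $\nu,\rho_1,\rho_2,\rho_3$ such that (1) $\deg(\mathcal{Z}_\gamma)\le\nu$ for all $\gamma\in\Gamma$; (2) $2\le\rho_1\le\eta$, $2\le\rho_2\le p$, and $0\le\rho_3\le p^2-1$; (3) there are at least $\rho_3+1$ values $\gamma\in\Gamma$ with $\#\mathcal{Z}_\gamma(\mathbb{F}_{p^h})\ge\nu(\eta-\rho_1+p-\rho_2)+1$. Let $T=\{(x,y,z)\in\mathcal{S}(\mathbb{F}_{p^h}): z\in\Gamma\}$ and $$V=\langle x^iy^jz^k: 0\le i\le\eta-\rho_1,\ 0\le j\le p-\rho_2,\ 0\le k\le\rho_3\rangle\subset\mathbb{F}_{p^h}[x,y,z],$$ and let $C=C(V,T)$. Then $C$ has hierarchical locality in the following sense: for every position $i$, corresponding to a point $P_i=(a,b,c)\in T$, (a) the lower code $C_{2,i}$ (the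 puncturing of $C$ to the $p$ positions of the fiber $\{(a,b+\delta,c):\delta\in\mathbb{F}_p\}\subset T$ of $\pi_{x,z}$ through $P_i$) has dimension at most $s_2=p-\rho_2+1$ and minimum distance at least $d_2=\rho_2$; (b) the middle code $C_{1,i}$ (the puncturing of $C$ to the positions of the points of $T$ with $z$-coordinate $c$, i.e. the points of $\mathcal{Z}_c(\mathbb{F}_{p^h})$) has dimension at most $s_1=(\eta-\rho_1+1)(p-\rho_2+1)$ and minimum distance at least $d_1=\rho_1\rho_2$, and contains the support of $C_{2,i}$. Furthermore the evaluation map on $V$ is injective, so $\dim C=(\eta-\rho_1+1)(p-\rho_2+1)(\rho_3+1)$.
   Context: A linear code of length $n$ over $\mathbb{F}_q$ is a subspace of $\mathbb{F}_q^n$; its minimum distance is the minimum Hamming distance between distinct codewords. For $I=\{i_1,\dots,i_s\}\subset\{1,\dots,n\}$, the punctured code $C|_I=\{(c_{i_1},\dots,c_{i_s}):(c_1,\dots,c_n)\in C\}$. For an ordered finite set $T=\{P_1,\dots,P_n\}$ of points and a vector space $V$ of polynomial functions, the evaluation code is $C(V,T)=\{(g(P_1),\dots,g(P_n)):g\in V\}$ (the ordering of $T$ is arbitrary). $\pi_x(a,b,c)=a$, $\pi_z(a,b,c)=c$, $\pi_{x,z}(a,b,c)=(a,c)$ are the coordinate projections on $\mathbb{A}^3$. $\deg(\mathcal{Z}_\gamma)$ denotes the degree of the plane curve $y^p-y=f(x,\gamma)$. -}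

module Defs where

open import Algebra.Bundles using (CommutativeRing; Semiring)
open import Algebra.Module.Bundles using (RawLeftModule)
import Algebra.Definitions.RawMonoid as RawMonoidDefs
import Algebra.Definitions.RawSemiring as RawSemiringDefs
open import Data.Bool using (if_then_else_; not)
open import Data.Fin using (Fin; zero; suc)
import Data.Fin.Properties as Fin
open import Data.Fin.Subset using (Subset; inside; outside; ∣_∣)
open import Data.List using (List; []; _∷_; _++_; map; foldr)
open import Data.List.Relation.Unary.All using (All)
open import Data.Nat using (ℕ; _≤_)
import Data.Nat as ℕ
open import Data.Product using (∃-syntax; _×_; _,_; proj₁)
open import Data.Vec using (Vec; []; _∷_; tabulate)
import Data.Vec as Vec
open import Data.Vec.Functional using (Vector)
import Data.Vec.Properties as Vec
import Data.Vec.Relation.Binary.Equality.DecSetoid as VecEquality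
open import Function.Bundles using (Bijection)
open import Level using (Level; _⊔_) renaming (suc to lsuc)
open import Relation.Binary using (Setoid; DecSetoid)
import Relation.Binary.Construct.On as On
import Relation.Binary.PropositionalEquality as ≡
open import Relation.Nullary using (¬_; does)
open import Relation.Unary using (Pred; Decidable; _∈_)

private
  variable
    a r ℓ′ : Level

-- ⟦ X ⟧ : the subset X, with equality inherited from the ambient setoid.
⟦_⟧ : {S : Setoid a ℓ′} → Pred (Setoid.Carrier S) r → Setoid (a ⊔ r) ℓ′
⟦_⟧ {S = S} X = On.setoid S (proj₁ {B = X})

-- HasSize S X n: a listing of X by Fin n, without repetition up to the
-- equality of S; it both witnesses #X = n and fixes an ordering of X.
HasSize : (S : Setoid a ℓ′) → Pred (Setoid.Carrier S) r → ℕ → Set (a ⊔ r ⊔ ℓ′)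
HasSize S X n = Bijection (≡.setoid (Fin n)) (⟦_⟧ {S = S} X)

SizeAtLeast : (S : Setoid a ℓ′) → Pred (Setoid.Carrier S) r → ℕ → Set (a ⊔ r ⊔ ℓ′)
SizeAtLeast S X k = ∃[ n ] (HasSize S X n × k ≤ n)

decSubset : ∀ {n} {P : Pred (Fin n) r} → Decidable P → Subset n
decSubset P? = tabulate (λ i → does (P? i))

-- The k-th smallest element of I.
nth : ∀ {n} (I : Subset n) → Fin ∣ I ∣ → Fin n
nth (outside ∷ I) k       = suc (nth I k)
nth (inside  ∷ I) zero    = zero
nth (inside  ∷ I) (suc k) = suc (nth I k)

record FiniteField c ℓ (q : ℕ) : Set (lsuc (c ⊔ ℓ)) where
  field
    commutativeRing : CommutativeRing c ℓ
  open CommutativeRing commutativeRing public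
  field
    0≉1         : ¬ 0# ≈ 1#
    inverse     : ∀ x → ¬ x ≈ 0# → ∃[ y ] x * y ≈ 1#
    enumeration : Bijection (≡.setoid (Fin q)) setoid

module OverField {c ℓ q} (𝔽 : FiniteField c ℓ q) where
  open FiniteField 𝔽 public
    using (Carrier; _≈_; _≉_; _+_; _*_; -_; 0#; 1#; setoid)
  private
    module 𝔽 = FiniteField 𝔽
  open RawSemiringDefs (Semiring.rawSemiring 𝔽.semiring) public
    using (_^_) renaming (_×_ to _·_)

  decSetoid : DecSetoid c ℓ
  decSetoid = Fin.inj⇒decSetoid
    (Inverse⇒Injection (sym-↔ (Bijection⇒Inverse 𝔽.enumeration)))
    where
    open import Function.Properties.Bijection using (Bijection⇒Inverse)
    open import Function.Properties.Inverse using (Inverse⇒Injection)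
      renaming (sym to sym-↔)

  -- Subspaces of an 𝔽-vector space.  Only the operations of the ambient space
  -- are needed, so it is given as a raw module; closure under negation
  -- is closure under the scalar - 1#.
  module _ {m ℓm} (M : RawLeftModule Carrier m ℓm) where
    open RawLeftModule M

    record Subspace s : Set (c ⊔ m ⊔ ℓm ⊔ lsuc s) where
      field
        Member    : Pred Carrierᴹ s
        respects  : ∀ {u v} → u ≈ᴹ v → Member u → Member v
        0-closed  : Member 0ᴹ
        +-closed  : ∀ {u v} → Member u → Member v → Member (u +ᴹ v)
        *ₗ-closed : ∀ a {v} → Member v → Member (a *ₗ v)

    data Span {x} (X : Pred Carrierᴹ x) : Pred Carrierᴹ (c ⊔ m ⊔ ℓm ⊔ x) where
      by-∈  : ∀ {v} → v ∈ X → v ∈ Span X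
      by-≈  : ∀ {u v} → u ≈ᴹ v → u ∈ Span X → v ∈ Span X
      by-0  : 0ᴹ ∈ Span X
      by-+  : ∀ {u v} → u ∈ Span X → v ∈ Span X → (u +ᴹ v) ∈ Span X
      by-*ₗ : ∀ a {v} → v ∈ Span X → (a *ₗ v) ∈ Span X

    span : ∀ {x} → Pred Carrierᴹ x → Subspace (c ⊔ m ⊔ ℓm ⊔ x)
    span X = record
      { Member    = Span X
      ; respects  = by-≈
      ; 0-closed  = by-0
      ; +-closed  = by-+
      ; *ₗ-closed = by-*ₗ
      }

    linearCombination : ∀ {d} → Vector Carrier d → Vector Carrierᴹ d → Carrierᴹ
    linearCombination a b =
      RawMonoidDefs.sum +ᴹ-rawMonoid (λ k → a k *ₗ b k)

    record Basis {s} (W : Subspace s) (d : ℕ) : Set (c ⊔ ℓ ⊔ m ⊔ ℓm ⊔ s) where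
      open Subspace W using (Member)
      field
        vectors     : Vector Carrierᴹ d
        members     : ∀ k → Member (vectors k)
        independent : ∀ a → linearCombination a vectors ≈ᴹ 0ᴹ → ∀ k → a k ≈ 0#
        spanning    : ∀ w → Member w → ∃[ a ] w ≈ᴹ linearCombination a vectors

  HasDimension : ∀ {m ℓm s} {M : RawLeftModule Carrier m ℓm} →
                 Subspace M s → ℕ → Set (c ⊔ ℓ ⊔ m ⊔ ℓm ⊔ s)
  HasDimension {M = M} W d = Basis M W d

  DimensionAtMost : ∀ {m ℓm s} {M : RawLeftModule Carrier m ℓm} →
                    Subspace M s → ℕ → Set (c ⊔ ℓ ⊔ m ⊔ ℓm ⊔ s)
  DimensionAtMost W k = ∃[ d ] (HasDimension W d × d ≤ k)

  -- A polynomial in m variables is a formal finite sum of terms (coefficient,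
  -- exponent vector), not necessarily reduced; two are equal when all their
  -- coefficients agree.
  Polynomial : ℕ → Set c
  Polynomial m = List (Carrier × Vec ℕ m)

  coefficient : ∀ {m} → Polynomial m → Vec ℕ m → Carrier
  coefficient g e = foldr
    (λ (a , e′) s → if does (Vec.≡-dec ℕ._≟_ e′ e) then a + s else s) 0# g

  infix 4 _≈ₚ_
  _≈ₚ_ : ∀ {m} → Polynomial m → Polynomial m → Set ℓ
  g ≈ₚ h = ∀ e → coefficient g e ≈ coefficient h e

  monomial : ∀ {m} → Vec ℕ m → Polynomial m
  monomial e = (1# , e) ∷ []

  constant : ∀ {m} → Carrier → Polynomial m
  constant {m} a = (a , Vec.replicate m 0) ∷ []

  negate : ∀ {m} → Polynomial m → Polynomial m
  negate = map (λ (a , e) → - a , e)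

  scale : ∀ {m} → Carrier → Polynomial m → Polynomial m
  scale b = map (λ (a , e) → b * a , e)

  polynomials : ℕ → RawLeftModule Carrier c ℓ
  polynomials m = record
    { Carrierᴹ = Polynomial m
    ; _≈ᴹ_     = _≈ₚ_
    ; _+ᴹ_     = _++_
    ; _*ₗ_     = scale
    ; 0ᴹ       = []
    ; -ᴹ_      = negate
    }

  IsConstant : ∀ {m} → Polynomial m → Set (c ⊔ ℓ)
  IsConstant g = ∃[ a ] g ≈ₚ constant a

  HasDegree : ∀ {m} → Polynomial m → ℕ → Set ℓ
  HasDegree g d =
    (∃[ e ] (coefficient g e ≉ 0# × Vec.sum e ≡.≡ d)) ×
    (∀ e → coefficient g e ≉ 0# → Vec.sum e ≤ d)

  𝔸 : ℕ → Set c
  𝔸 m = Vec Carrier m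

  𝔸-decSetoid : ℕ → DecSetoid c (c ⊔ ℓ)
  𝔸-decSetoid m = record
    { isDecEquivalence = VecEquality.≋-isDecEquivalence decSetoid m }

  𝔸-setoid : ℕ → Setoid c (c ⊔ ℓ)
  𝔸-setoid m = DecSetoid.setoid (𝔸-decSetoid m)

  infix 4 _≈ₐ_
  _≈ₐ_ : ∀ {m} → 𝔸 m → 𝔸 m → Set (c ⊔ ℓ)
  _≈ₐ_ {m} = Setoid._≈_ (𝔸-setoid m)

  power : ∀ {m} → 𝔸 m → Vec ℕ m → Carrier
  power []      []      = 1#
  power (x ∷ Q) (i ∷ e) = x ^ i * power Q e

  evaluate : ∀ {m} → Polynomial m → 𝔸 m → Carrier
  evaluate g Q = foldr (λ (a , e) s → a * power Q e + s) 0# g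

  -- 𝔽-rational points of the zero locus of finitely many polynomials.
  Zeros : ∀ {m} → List (Polynomial m) → Pred (𝔸 m) (c ⊔ ℓ)
  Zeros gs Q = All (λ g → evaluate g Q ≈ 0#) gs

  πx πz : 𝔸 3 → Carrier
  πx (a ∷ b ∷ c ∷ []) = a
  πz (a ∷ b ∷ c ∷ []) = c

  πxz : 𝔸 3 → 𝔸 2
  πxz (a ∷ b ∷ c ∷ []) = a ∷ c ∷ []

  𝔽^ : ℕ → RawLeftModule Carrier c ℓ
  𝔽^ n = record
    { Carrierᴹ = Vector Carrier n
    ; _≈ᴹ_     = λ u v → ∀ k → u k ≈ v k
    ; _+ᴹ_     = λ u v k → u k + v k
    ; _*ₗ_     = λ a v k → a * v k
    ; 0ᴹ       = λ _ → 0#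
    ; -ᴹ_      = λ v k → - v k
    }

  LinearCode : ℕ → Set (lsuc (c ⊔ ℓ))
  LinearCode n = Subspace (𝔽^ n) (c ⊔ ℓ)

  distance : ∀ {n} → Vector Carrier n → Vector Carrier n → ℕ
  distance u v = ∣ tabulate (λ k → not (does (u k ≟ v k))) ∣
    where open DecSetoid decSetoid using (_≟_)

  MinimumDistanceAtLeast : ∀ {n} → LinearCode n → ℕ → Set (c ⊔ ℓ)
  MinimumDistanceAtLeast C d =
    ∀ u v → Member u → Member v → ¬ (∀ k → u k ≈ v k) → d ≤ distance u v
    where open Subspace C

  puncture : ∀ {n} → LinearCode n → (I : Subset n) → LinearCode ∣ I ∣
  puncture C I = record
    { Member    = λ w → ∃[ u ] (Member u × (∀ k → w k ≈ u (nth I k)))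
    ; respects  = λ w≈w′ (u , mem , eq) →
                    u , mem , λ k → 𝔽.trans (𝔽.sym (w≈w′ k)) (eq k)
    ; 0-closed  = _ , 0-closed , λ _ → 𝔽.refl
    ; +-closed  = λ (u , mem , eq) (u′ , mem′ , eq′) →
                    _ , +-closed mem mem′ , λ k → 𝔽.+-cong (eq k) (eq′ k)
    ; *ₗ-closed = λ a (u , mem , eq) →
                    _ , *ₗ-closed a mem , λ k → 𝔽.*-congˡ (eq k)
    }
    where open Subspace C

  evaluate-++ : ∀ {m} (g h : Polynomial m) Q →
                evaluate (g ++ h) Q ≈ evaluate g Q + evaluate h Q
  evaluate-++ []            h Q = 𝔽.sym (𝔽.+-identityˡ _)
  evaluate-++ ((a , e) ∷ g) h Q =
    𝔽.trans (𝔽.+-congˡ (evaluate-++ g h Q)) (𝔽.sym (𝔽.+-assoc _ _ _))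

  evaluate-scale : ∀ {m} b (g : Polynomial m) Q →
                   evaluate (scale b g) Q ≈ b * evaluate g Q
  evaluate-scale b []            Q = 𝔽.sym (𝔽.zeroʳ b)
  evaluate-scale b ((a , e) ∷ g) Q =
    𝔽.trans (𝔽.+-cong (𝔽.*-assoc _ _ _) (evaluate-scale b g Q))
            (𝔽.sym (𝔽.distribˡ _ _ _))

  evaluations : ∀ {m n} → Vector (𝔸 m) n → Polynomial m → Vector Carrier n
  evaluations P g k = evaluate g (P k)

  -- The evaluation code C(V, T), for the points of T listed as P.
  evaluationCode : ∀ {m n} → Subspace (polynomials m) (c ⊔ ℓ) →
                   Vector (𝔸 m) n → LinearCode n
  evaluationCode V P = record
    { Member    = λ w → ∃[ g ] (Member g × (∀ k → w k ≈ evaluations P g k))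
    ; respects  = λ w≈w′ (g , mem , eq) →
                    g , mem , λ k → 𝔽.trans (𝔽.sym (w≈w′ k)) (eq k)
    ; 0-closed  = [] , 0-closed , λ _ → 𝔽.refl
    ; +-closed  = λ (g , mem , eq) (h , mem′ , eq′) →
                    g ++ h , +-closed mem mem′ , λ k →
                    𝔽.trans (𝔽.+-cong (eq k) (eq′ k)) (𝔽.sym (evaluate-++ g h (P k)))
    ; *ₗ-closed = λ a (g , mem , eq) →
                    scale a g , *ₗ-closed a mem , λ k →
                    𝔽.trans (𝔽.*-congˡ (eq k)) (𝔽.sym (evaluate-scale a g (P k)))
    }
    where open Subspace V

  -- The exponent vectors of f are those of (x, z).
  module Surface (p : ℕ) (f : Polynomial 2) where

    -- y^p - y - f(x, z)
    surface : Polynomial 3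
    surface =
      monomial (0 ∷ p ∷ 0 ∷ []) ++
      negate (monomial (0 ∷ 1 ∷ 0 ∷ [])) ++
      negate (map (λ { (a , i ∷ k ∷ []) → a , i ∷ 0 ∷ k ∷ [] }) f)

    -- f(x, γ)
    section : Carrier → Polynomial 1
    section γ = map (λ { (a , i ∷ k ∷ []) → a * γ ^ k , i ∷ [] }) f

    -- The equation y^p - y - f(x, γ) of 𝒵 γ in the coordinates (x, y) of the
    -- plane z = γ.  It is squarefree (its derivative in y is - 1# when q is a
    -- power of p), so its total degree is the degree of the curve.
    planeEquation : Carrier → Polynomial 2
    planeEquation γ =
      monomial (0 ∷ p ∷ []) ++
      negate (monomial (0 ∷ 1 ∷ [])) ++
      negate (map (λ { (a , i ∷ []) → a , i ∷ 0 ∷ [] }) (section γ))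

    𝒮 : Pred (𝔸 3) (c ⊔ ℓ)
    𝒮 = Zeros (surface ∷ [])

    -- The second equation is z - γ.
    𝒵 : Carrier → Pred (𝔸 3) (c ⊔ ℓ)
    𝒵 γ = Zeros (surface ∷ (monomial (0 ∷ 0 ∷ 1 ∷ []) ++ negate (constant γ)) ∷ [])

    πx𝒵 : Carrier → Pred Carrier (c ⊔ ℓ)
    πx𝒵 γ a = ∃[ Q ] (Q ∈ 𝒵 γ × πx Q ≈ a)

    Γ : ℕ → Pred Carrier (c ⊔ ℓ)
    Γ η γ = ¬ IsConstant (section γ) × SizeAtLeast setoid (πx𝒵 γ) η

    T : ℕ → Pred (𝔸 3) (c ⊔ ℓ)
    T η Q = Q ∈ 𝒮 × πz Q ∈ Γ η

  data BoxMonomial (l m n : ℕ) : Pred (Polynomial 3) (c ⊔ ℓ) where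
    xⁱyʲzᵏ : ∀ {i j k} → i ≤ l → j ≤ m → k ≤ n →
             monomial (i ∷ j ∷ k ∷ []) ∈ BoxMonomial l m n

  boxSpace : (l m n : ℕ) → Subspace (polynomials 3) (c ⊔ ℓ)
  boxSpace l m n = span (polynomials 3) (BoxMonomial l m n)

  module Positions {n} (P : Vector (𝔸 3) n) where
    private
      module 𝔸² = DecSetoid (𝔸-decSetoid 2)
      module F  = DecSetoid decSetoid

    -- Positions of the points with the same image as P i under πxz, resp. πz.
    lower middle : Fin n → Subset n
    lower  i = decSubset (λ j → πxz (P j) 𝔸².≟ πxz (P i))
    middle i = decSubset (λ j → πz (P j) F.≟ πz (P i))

{-# OPTIONS --safe #-}
module Submission where

-- Since q · 1 = 0 forces p · 1 = 0, the p-th power map is additive, so the points of the surface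
-- over a given (x, z) form one coset of the prime field in y.  For γ ∈ Γ the curve 𝒵 γ therefore
-- consists of at least η full fibres of p points each.  On such a union of fibres a polynomial
-- whose degrees in x, y and z are bounded by l < η, m < p and o is controlled by counting roots in
-- one variable at a time: if it vanishes on the fibres over o + 1 values of z it is zero, and if it
-- is non-zero somewhere on 𝒵 γ then some coefficient of a power of y is non-zero at η - l or more
-- values of x, above each of which at least p - m points are non-zeros.

open import Defs
open import Data.Bool using (if_then_else_)
open import Data.Fin using (Fin; toℕ; fromℕ; fromℕ<; zero; suc; inject≤; inject₁)
open import Data.Fin using (combine; remQuot; _↑ˡ_; _↑ʳ_)
open import Data.Fin.Permutation using (Permutation; permutation)
import Data.Fin.Properties as Fin
open import Data.Fin.Subset using (Subset; inside; outside; ∣_∣; _∈_; _⊆_; ∁)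
import Data.Fin.Subset.Properties as Subset
open import Data.List using ([]; _∷_; _++_; filter; length; map)
import Data.List.Properties as List
open import Data.List.Relation.Unary.All using ([]; _∷_)
open import Data.List.Relation.Unary.Any using (here)
open import Data.Nat as ℕ using (ℕ; _≤_; _∸_; _!)
open import Data.Nat.Combinatorics using (nCn≡1; nCk≡n!/k![n-k]!; k![n∸k]!∣n!)
  renaming (_C_ to _choose_)
open import Data.Nat.Coprimality using (prime⇒coprime; coprime-Bézout)
open import Data.Nat.Divisibility using (_∣_; divides; ∣⇒≤; ∣1⇒≡1; ∣-trans; ∣-reflexive; m∣m*n)
open import Data.Nat.DivMod using (m/n*n≡m)
import Data.Nat.GCD as GCD
open import Data.Nat.Primality using (Prime; euclidsLemma; prime⇒nonZero; prime⇒nonTrivial)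
import Data.Nat.Properties as ℕ
open import Data.Product using (_×_; ∃-syntax; Σ-syntax; _,_; proj₁; proj₂; uncurry; map₂)
open import Data.Sum using (inj₁; inj₂; [_,_]′)
open import Data.Vec using (Vec; _∷_; []; here; there)
open import Data.Vec.Functional using (Vector; tail)
import Data.Vec.Properties as Vec
open import Data.Vec.Relation.Binary.Pointwise.Inductive using ([]; _∷_)
open import Function using (_∘_; Injective)
open import Function.Bundles using (Bijection; _⇔_; mk⇔)
open import Relation.Binary using (Setoid; DecSetoid)
open import Relation.Binary.PropositionalEquality as ≡ using (_≡_)
open import Relation.Nullary using (¬_; Dec; yes; no; does; ¬?; contradiction)
open import Relation.Nullary.Decidable using (dec-true; decidable-stable)
open import Relation.Unary using (Pred; Decidable)

-- The points of `T` do not form a product: the available x depend on z, and the available y on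
-- both. Iterated root counting tolerates such a triangular shape as long as y is eliminated before
-- x and x before z. The designed distances are what the degrees leave over: with l = η - ρ₁ and m =
-- p - ρ₂ there remain η - l = ρ₁ values of x and p - m = ρ₂ points above each. Fixing z turns its
-- powers into constants that are absorbed into the coefficients, so the lower and the middle code
-- are two cases of one situation, with one fibre and with η fibres. A further obstacle is that an
-- element of `V` is a list of terms up to equality of coefficients, so its values must first be
-- shown to depend only on finitely many coefficients.

private variable
  n : ℕ

-- Positions selected by a subset, and counting them

nth-injective : (I : Subset n) → Injective _≡_ _≡_ (nth I)
nth-injective (outside ∷ I) eq = nth-injective I (Fin.suc-injective eq)
nth-injective (inside ∷ I) {zero}  {zero}  eq = ≡.refl
nth-injective (inside ∷ I) {suc j} {suc k} eq =
  ≡.cong suc (nth-injective I (Fin.suc-injective eq))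

nth-∈ : (I : Subset n) (k : Fin ∣ I ∣) → nth I k ∈ I
nth-∈ (outside ∷ I) k       = there (nth-∈ I k)
nth-∈ (inside ∷ I)  zero    = here
nth-∈ (inside ∷ I)  (suc k) = there (nth-∈ I k)

nth-surjective : (I : Subset n) {j : Fin n} → j ∈ I → ∃[ k ] nth I k ≡ j
nth-surjective (inside ∷ I)  here        = zero , ≡.refl
nth-surjective (inside ∷ I)  (there j∈I) with nth-surjective I j∈I
... | k , ≡.refl = suc k , ≡.refl
nth-surjective (outside ∷ I) (there j∈I) with nth-surjective I j∈I
... | k , ≡.refl = k , ≡.refl

injection⇒≤∣∣ : ∀ {m} (I : Subset n) (f : Fin m → Fin n) → Injective _≡_ _≡_ f →
               (∀ k → f k ∈ I) → m ≤ ∣ I ∣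
injection⇒≤∣∣ I f f-injective f∈I = Fin.injective⇒≤ {f = index} index-injective
  where
  index = λ k → proj₁ (nth-surjective I (f∈I k))
  index-injective : Injective _≡_ _≡_ index
  index-injective {j} {k} eq = f-injective (≡.trans
    (≡.sym (proj₂ (nth-surjective I (f∈I j))))
    (≡.trans (≡.cong (nth I) eq) (proj₂ (nth-surjective I (f∈I k)))))

module _ {r} {P : Pred (Fin n) r} (P? : Decidable P) where

  ∈-decSubset⁺ : ∀ {j} → P j → j ∈ decSubset P?
  ∈-decSubset⁺ {j} pj = Vec.lookup⇒[]= j _
    (≡.trans (Vec.lookup∘tabulate _ j) (dec-true (P? j) pj))

  ∈-decSubset⁻ : ∀ {j} → j ∈ decSubset P? → P j
  ∈-decSubset⁻ {j} j∈
    with P? j | ≡.trans (≡.sym (Vec.lookup∘tabulate (does ∘ P?) j)) (Vec.[]=⇒lookup j∈)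
  ... | yes pj | _ = pj

-- Binomial coefficients modulo a prime

prime∣!⇒≤ : ∀ {p} → Prime p → ∀ m → p ∣ m ! → p ≤ m
prime∣!⇒≤ pPrime ℕ.zero    p∣1 =
  contradiction (∣1⇒≡1 p∣1) (ℕ.nonTrivial⇒≢1 {{prime⇒nonTrivial pPrime}})
prime∣!⇒≤ pPrime (ℕ.suc m) p∣1+m! with euclidsLemma (ℕ.suc m) (m !) pPrime p∣1+m!
... | inj₁ p∣1+m = ∣⇒≤ p∣1+m
... | inj₂ p∣m!  = ℕ.m≤n⇒m≤1+n (prime∣!⇒≤ pPrime m p∣m!)

-- `p` divides `p !`, which is the binomial coefficient times `k !` and `(p ∸ k) !`; by Euclid's
-- lemma it must divide one of the three, and the two factorials are excluded by their size.
prime∣choose : ∀ {p k} → Prime p → 0 ℕ.< k → k ℕ.< p → p ∣ p choose k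
prime∣choose {p} {k} pPrime 0<k k<p
  with euclidsLemma (p choose k) (k ! ℕ.* (p ∸ k) !) pPrime p∣pCk*k![p∸k]!
  where
  n∣n! : ∀ n → 0 ℕ.< n → n ∣ n !
  n∣n! (ℕ.suc n) _ = m∣m*n (n !)
  pCk*k![p∸k]!≡p! : (p choose k) ℕ.* (k ! ℕ.* (p ∸ k) !) ≡ p !
  pCk*k![p∸k]!≡p! = ≡.trans
    (≡.cong (ℕ._* (k ! ℕ.* (p ∸ k) !)) (nCk≡n!/k![n-k]! (ℕ.<⇒≤ k<p)))
    (m/n*n≡m {{k ℕ.!* p ∸ k !≢0}} (k![n∸k]!∣n! (ℕ.<⇒≤ k<p)))
  p∣pCk*k![p∸k]! : p ∣ (p choose k) ℕ.* (k ! ℕ.* (p ∸ k) !)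
  p∣pCk*k![p∸k]! = ∣-trans (n∣n! p (ℕ.<-trans 0<k k<p)) (∣-reflexive (≡.sym pCk*k![p∸k]!≡p!))
... | inj₁ p∣pCk = p∣pCk
... | inj₂ p∣k![p∸k]! with euclidsLemma (k !) ((p ∸ k) !) pPrime p∣k![p∸k]!
...   | inj₁ p∣k!     = contradiction (prime∣!⇒≤ pPrime k p∣k!) (ℕ.<⇒≱ k<p)
...   | inj₂ p∣[p∸k]! = contradiction (prime∣!⇒≤ pPrime (p ∸ k) p∣[p∸k]!)
  (ℕ.<⇒≱ (ℕ.∸-monoʳ-< 0<k (ℕ.<⇒≤ k<p)))

-- The listing itself is kept: elements are compared in the ambient setoid only, so exchanging the
-- membership proofs disturbs neither injectivity nor surjectivity.
HasSize-⇔ : ∀ {a ℓ r s n} {S : Setoid a ℓ}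
            {X : Pred (Setoid.Carrier S) r} {Y : Pred (Setoid.Carrier S) s} →
            (∀ {x} → X x → Y x) → (∀ {x} → Y x → X x) → HasSize S X n → HasSize S Y n
HasSize-⇔ {S = S} X⊆Y Y⊆X size = record
  { to        = λ k → proj₁ (to k) , X⊆Y (proj₂ (to k))
  ; cong      = cong
  ; bijective = injective , λ (y , y∈Y) → surjective (y , Y⊆X y∈Y)
  }
  where open Bijection size

module OverFiniteField {c ℓ q} (𝔽 : FiniteField c ℓ q) where

  open OverField 𝔽
  open FiniteField 𝔽 hiding (Carrier; _≈_; _≉_; _+_; _*_; -_; 0#; 1#; setoid; zero)
  open DecSetoid decSetoid using (_≟_)
  open import Algebra.Properties.AbelianGroup +-abelianGroup using (⁻¹-∙-comm)
  import Algebra.Properties.CommutativeSemigroup as CommutativeSemigroup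
  open CommutativeSemigroup *-commutativeSemigroup using (x∙yz≈y∙xz)
  import Algebra.Properties.CommutativeSemiring.Binomial commutativeSemiring as Binomial
  open import Algebra.Properties.Group +-group
    using (x∙y⁻¹≈ε⇒x≈y; x≈y⇒x∙y⁻¹≈ε; ∙-cancelˡ; ∙-cancelʳ; //-rightDividesˡ)
  open import Algebra.Properties.Ring ring using (-‿distribˡ-*; [y-z]x≈yx-zx; -1*x≈-x; -0#≈0#)
  open import Algebra.Properties.Semiring.Exp semiring hiding (_^_)
  open import Algebra.Properties.Semiring.Mult semiring hiding (_×_)
  open import Algebra.Properties.Semiring.Sum semiring
  import Algebra.Solver.Ring.NaturalCoefficients.Default commutativeSemiring as Solver
  open import Relation.Binary.Reasoning.Setoid setoid

  -- Univariate polynomials and their roots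

  Distinct : ∀ {n} → Vector Carrier n → Set ℓ
  Distinct = Injective _≡_ _≈_

  singleton-distinct : ∀ x → Distinct {1} (λ _ → x)
  singleton-distinct x {zero} {zero} _ = ≡.refl

  x*y≈0⇒y≈0 : ∀ {x y} → x ≉ 0# → x * y ≈ 0# → y ≈ 0#
  x*y≈0⇒y≈0 {x} {y} x≉0 xy≈0 with inverse x x≉0
  ... | x⁻¹ , x*x⁻¹≈1 = begin
    y              ≈⟨ *-identityˡ y ⟨
    1# * y         ≈⟨ *-congʳ x*x⁻¹≈1 ⟨
    x * x⁻¹ * y    ≈⟨ *-congʳ (*-comm x x⁻¹) ⟩
    x⁻¹ * x * y    ≈⟨ *-assoc _ _ _ ⟩
    x⁻¹ * (x * y)  ≈⟨ *-congˡ xy≈0 ⟩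
    x⁻¹ * 0#       ≈⟨ zeroʳ _ ⟩
    0#             ∎

  x*z≈y*z⇒z≈0 : ∀ {x y z} → x ≉ y → x * z ≈ y * z → z ≈ 0#
  x*z≈y*z⇒z≈0 {x} {y} {z} x≉y eq = x*y≈0⇒y≈0 (x≉y ∘ x∙y⁻¹≈ε⇒x≈y x y) (begin
    (x - y) * z    ≈⟨ [y-z]x≈yx-zx z x y ⟩
    x * z - y * z  ≈⟨ +-congʳ eq ⟩
    y * z - y * z  ≈⟨ -‿inverseʳ _ ⟩
    0#             ∎)

  -- `d` counts coefficients, so the degree is below `d`.
  poly : ∀ {d} → Vector Carrier d → Carrier → Carrier
  poly {d} a x = ∑[ i < d ] (a i * x ^ toℕ i)

  poly-cong : ∀ {d} {a b : Vector Carrier d} {x y} → (∀ i → a i ≈ b i) → x ≈ y →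
              poly a x ≈ poly b y
  poly-cong a≈b x≈y = sum-cong-≋ λ i → *-cong (a≈b i) (^-congˡ (toℕ i) x≈y)

  poly-0 : ∀ {d} {a : Vector Carrier d} x → (∀ i → a i ≈ 0#) → poly a x ≈ 0#
  poly-0 {d} x a≈0 = trans
    (sum-cong-≋ λ i → trans (*-congʳ (a≈0 i)) (zeroˡ _)) (sum-replicate-zero d)

  poly-+ : ∀ {d} (a b : Vector Carrier d) x →
           poly (λ i → a i + b i) x ≈ poly a x + poly b x
  poly-+ a b x = trans (sum-cong-≋ λ i → distribʳ (x ^ toℕ i) (a i) (b i))
    (∑-distrib-+ (λ i → a i * x ^ toℕ i) (λ i → b i * x ^ toℕ i))

  poly-* : ∀ {d} s (a : Vector Carrier d) x → poly (λ i → s * a i) x ≈ s * poly a x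
  poly-* s a x = trans (sum-cong-≋ λ i → *-assoc s (a i) (x ^ toℕ i))
    (sym (*-distribˡ-sum s (λ i → a i * x ^ toℕ i)))

  poly-single : ∀ {d} (a : Vector Carrier d) k x → (∀ i → ¬ i ≡ k → a i ≈ 0#) →
                poly a x ≈ a k * x ^ toℕ k
  poly-single {ℕ.suc d} a k x a≈0 = trans (sum-remove {i = k} (λ i → a i * x ^ toℕ i)) (trans
    (+-congˡ (trans (sum-cong-≋ λ i →
      trans (*-congʳ (a≈0 _ (Fin.punchInᵢ≢i k i))) (zeroˡ _)) (sum-replicate-zero d)))
    (+-identityʳ _))

  horner : ∀ {d} (a : Vector Carrier (ℕ.suc d)) x → poly a x ≈ a zero + x * poly (tail a) x
  horner a x = +-cong (*-identityʳ _) (trans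
    (sum-cong-≋ λ i → x∙yz≈y∙xz (a (suc i)) x (x ^ toℕ i))
    (sym (*-distribˡ-sum x (λ i → a (suc i) * x ^ toℕ i))))

  -- Synthetic division by the linear factor with root `r`: the entries are the values at `r` of the
  -- successive tails of `a`, as in Horner's scheme.
  quotient : ∀ {d} → Vector Carrier (ℕ.suc d) → Carrier → Vector Carrier d
  quotient {ℕ.suc d} a r zero    = poly (tail a) r
  quotient {ℕ.suc d} a r (suc i) = quotient (tail a) r i

  -- a(x) - a(r) = (x - r) b(x), with both sides moved so that no subtraction occurs.
  quotient-poly : ∀ {d} (a : Vector Carrier (ℕ.suc d)) r x →
    poly a x + r * poly (quotient a r) x ≈ poly a r + x * poly (quotient a r) x
  quotient-poly {ℕ.zero} a r x = +-congˡ (trans (zeroʳ r) (sym (zeroʳ x)))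
  quotient-poly {ℕ.suc d} a r x = begin
    poly a x + r * poly (quotient a r) x
      ≈⟨ +-cong (horner a x) (*-congˡ (horner (quotient a r) x)) ⟩
    (a zero + x * t x) + r * (t r + x * b)
      ≈⟨ Solver.solve 6 (λ a₀ x r tx tr b →
           (a₀ :+ x :* tx) :+ r :* (tr :+ x :* b) := a₀ :+ r :* tr :+ x :* (tx :+ r :* b))
           refl (a zero) x r (t x) (t r) b ⟩
    a zero + r * t r + x * (t x + r * b)
      ≈⟨ +-congˡ (*-congˡ (quotient-poly (tail a) r x)) ⟩
    a zero + r * t r + x * (t r + x * b)
      ≈⟨ +-cong (horner a r) (*-congˡ (horner (quotient a r) x)) ⟨
    poly a r + x * poly (quotient a r) x ∎
    where
    open Solver using (_:+_; _:*_; _:=_)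
    t = poly (tail a)
    b = poly (quotient (tail a) r) x

  -- The entries of the quotient are the values of the tails at `r`. Once these vanish, Horner's
  -- rule gives the coefficients of `a` as zero one after another.
  quotient-0 : ∀ {d} (a : Vector Carrier (ℕ.suc d)) r → poly a r ≈ 0# →
               (∀ i → quotient a r i ≈ 0#) → ∀ i → a i ≈ 0#
  quotient-0 {d} a r a[r]≈0 b≈0 zero = begin
    a zero                        ≈⟨ +-identityʳ _ ⟨
    a zero + 0#                   ≈⟨ +-congˡ (trans (*-congˡ (tail≈0 b≈0)) (zeroʳ r)) ⟨
    a zero + r * poly (tail a) r  ≈⟨ horner a r ⟨
    poly a r                      ≈⟨ a[r]≈0 ⟩
    0#                            ∎
    where
    tail≈0 : ∀ {d} {a : Vector Carrier (ℕ.suc d)} →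
             (∀ i → quotient a r i ≈ 0#) → poly (tail a) r ≈ 0#
    tail≈0 {ℕ.zero}  _   = refl
    tail≈0 {ℕ.suc d} b≈0 = b≈0 zero
  quotient-0 {ℕ.suc d} a r a[r]≈0 b≈0 (suc i) = quotient-0 (tail a) r (b≈0 zero) (b≈0 ∘ suc) i

  -- Divide out the first root: the others are roots of the quotient, because their non-zero
  -- differences from it can be cancelled.
  roots⇒0 : ∀ {d} (a xs : Vector Carrier d) → Distinct xs →
            (∀ k → poly a (xs k) ≈ 0#) → ∀ i → a i ≈ 0#
  roots⇒0 {ℕ.suc d} a xs distinct a[xs]≈0 =
    quotient-0 a r (a[xs]≈0 zero) (roots⇒0 (quotient a r) (tail xs)
      (Fin.suc-injective ∘ distinct) λ k →
      x*z≈y*z⇒z≈0 (λ eq → Fin.0≢1+n (distinct eq)) (begin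
        r * b k                        ≈⟨ +-identityˡ _ ⟨
        0# + r * b k                   ≈⟨ +-congʳ (a[xs]≈0 (suc k)) ⟨
        poly a (xs (suc k)) + r * b k  ≈⟨ quotient-poly a r (xs (suc k)) ⟩
        poly a r + xs (suc k) * b k    ≈⟨ +-congʳ (a[xs]≈0 zero) ⟩
        0# + xs (suc k) * b k          ≈⟨ +-identityˡ _ ⟩
        xs (suc k) * b k               ∎))
    where
    r = xs zero
    b = λ k → poly (quotient a r) (xs (suc k))

  roots≤⇒0 : ∀ {d m} (a : Vector Carrier d) (xs : Vector Carrier m) → d ≤ m → Distinct xs →
             (∀ k → poly a (xs k) ≈ 0#) → ∀ i → a i ≈ 0#
  roots≤⇒0 a xs d≤m distinct a[xs]≈0 = roots⇒0 a (λ k → xs (inject≤ k d≤m))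
    (λ eq → Fin.inject≤-injective d≤m d≤m _ _ (distinct eq)) (λ k → a[xs]≈0 (inject≤ k d≤m))

  -- Pigeonhole: with fewer than `r` non-roots, at least `d` of the `m` points would be roots and
  -- `a` would vanish. The bound says that `r` is at most `m` minus the degree bound `d - 1`,
  -- without subtraction.
  nonroots : ∀ {d m} (a : Vector Carrier d) (xs : Vector Carrier m) r → Distinct xs →
             r ℕ.+ d ≤ ℕ.suc m → ∃[ i ] a i ≉ 0# →
             ∃[ φ ] (Injective _≡_ _≡_ φ × (∀ (k : Fin r) → poly a (xs (φ k)) ≉ 0#))
  nonroots {d} {m} a xs r distinct r+d≤1+m (i , aᵢ≉0) = split (r ℕ.≤? ∣ nonzero ∣)
    where
    nonzero? : Decidable (λ k → poly a (xs k) ≉ 0#)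
    nonzero? k = ¬? (poly a (xs k) ≟ 0#)

    nonzero zeros : Subset m
    nonzero = decSubset nonzero?
    zeros = ∁ nonzero

    m≡∣nonzero∣+∣zeros∣ : m ≡ ∣ nonzero ∣ ℕ.+ ∣ zeros ∣
    m≡∣nonzero∣+∣zeros∣ = ≡.sym (≡.trans
      (≡.cong (∣ nonzero ∣ ℕ.+_) (Subset.∣∁p∣≡n∸∣p∣ nonzero))
      (ℕ.m+[n∸m]≡n (Subset.∣p∣≤n nonzero)))

    split : Dec (r ≤ ∣ nonzero ∣) →
            ∃[ φ ] (Injective _≡_ _≡_ φ × (∀ (k : Fin r) → poly a (xs (φ k)) ≉ 0#))
    split (yes r≤) = (λ k → nth nonzero (inject≤ k r≤))
      , (λ eq → Fin.inject≤-injective r≤ r≤ _ _ (nth-injective nonzero eq))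
      , (λ k → ∈-decSubset⁻ nonzero? (nth-∈ nonzero (inject≤ k r≤)))
    split (no r≰) = contradiction
      (roots≤⇒0 a (xs ∘ nth zeros) d≤∣zeros∣ (nth-injective zeros ∘ distinct)
        (λ k → decidable-stable (poly a _ ≟ 0#) λ ≉0 →
          Subset.x∈∁p⇒x∉p (nth-∈ zeros k) (∈-decSubset⁺ nonzero? ≉0)) i)
      aᵢ≉0
      where
      d≤∣zeros∣ : d ≤ ∣ zeros ∣
      d≤∣zeros∣ = ℕ.+-cancelˡ-≤ (ℕ.suc ∣ nonzero ∣) _ _ (ℕ.≤-trans
        (ℕ.+-monoˡ-≤ d (ℕ.≰⇒> r≰))
        (ℕ.≤-trans r+d≤1+m (ℕ.s≤s (ℕ.≤-reflexive m≡∣nonzero∣+∣zeros∣))))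

  poly≉0⇒coefficient≉0 : ∀ {d} (a : Vector Carrier d) x → poly a x ≉ 0# → ∃[ i ] a i ≉ 0#
  poly≉0⇒coefficient≉0 {d} a x a[x]≉0 =
    Fin.¬∀⟶∃¬ d _ (λ i → a i ≟ 0#) (a[x]≉0 ∘ poly-0 x)

  -- Formal polynomials and their coefficients

  infix 4 _≟ᵉ_
  _≟ᵉ_ : ∀ {m} (e e′ : Vec ℕ m) → Dec (e ≡ e′)
  _≟ᵉ_ = Vec.≡-dec ℕ._≟_

  power-cong : ∀ {m} {Q R : 𝔸 m} e → Q ≈ₐ R → power Q e ≈ power R e
  power-cong []      []          = refl
  power-cong (i ∷ e) (x≈y ∷ Q≈R) = *-cong (^-congˡ i x≈y) (power-cong e Q≈R)

  evaluate-cong : ∀ {m} (g : Polynomial m) {Q R} → Q ≈ₐ R → evaluate g Q ≈ evaluate g R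
  evaluate-cong []            Q≈R = refl
  evaluate-cong ((a , e) ∷ g) Q≈R = +-cong (*-congˡ (power-cong e Q≈R)) (evaluate-cong g Q≈R)

  coefficient-++ : ∀ {m} (g h : Polynomial m) e →
                   coefficient (g ++ h) e ≈ coefficient g e + coefficient h e
  coefficient-++ []             h e = sym (+-identityˡ _)
  coefficient-++ ((a , e′) ∷ g) h e with e′ ≟ᵉ e
  ... | yes _ = trans (+-congˡ (coefficient-++ g h e)) (sym (+-assoc _ _ _))
  ... | no  _ = coefficient-++ g h e

  coefficient-scale : ∀ {m} b (g : Polynomial m) e →
                      coefficient (scale b g) e ≈ b * coefficient g e
  coefficient-scale b []             e = sym (zeroʳ b)
  coefficient-scale b ((a , e′) ∷ g) e with e′ ≟ᵉ e
  ... | yes _ = trans (+-congˡ (coefficient-scale b g e)) (sym (distribˡ _ _ _))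
  ... | no  _ = coefficient-scale b g e

  coefficient-monomial-≡ : ∀ {m} (e : Vec ℕ m) → coefficient (monomial e) e ≈ 1#
  coefficient-monomial-≡ e with e ≟ᵉ e
  ... | yes _   = +-identityʳ 1#
  ... | no  e≢e = contradiction ≡.refl e≢e

  coefficient-monomial-≢ : ∀ {m} (e e′ : Vec ℕ m) → ¬ e ≡ e′ → coefficient (monomial e) e′ ≈ 0#
  coefficient-monomial-≢ e e′ e≢e′ with e ≟ᵉ e′
  ... | yes e≡e′ = contradiction e≡e′ e≢e′
  ... | no  _    = refl

  infixl 6 _⊖_
  _⊖_ : ∀ {m} → Polynomial m → Polynomial m → Polynomial m
  g ⊖ h = g ++ scale (- 1#) h

  evaluate-⊖ : ∀ {m} (g h : Polynomial m) Q → evaluate (g ⊖ h) Q ≈ evaluate g Q - evaluate h Q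
  evaluate-⊖ g h Q = trans (evaluate-++ g (scale (- 1#) h) Q)
    (+-congˡ (trans (evaluate-scale (- 1#) h Q) (-1*x≈-x _)))

  coefficient-⊖ : ∀ {m} (g h : Polynomial m) e →
                  coefficient (g ⊖ h) e ≈ coefficient g e - coefficient h e
  coefficient-⊖ g h e = trans (coefficient-++ g (scale (- 1#) h) e)
    (+-congˡ (trans (coefficient-scale (- 1#) h e) (-1*x≈-x _)))

  module _ {m} (e : Vec ℕ m) where

    -- A list of terms may repeat an exponent, so all terms with exponent `e` are removed at once;
    -- together they contribute the coefficient times one power product.
    without : Polynomial m → Polynomial m
    without = filter (λ t → ¬? (proj₂ t ≟ᵉ e))

    evaluate-without : ∀ g Q →
      evaluate g Q ≈ coefficient g e * power Q e + evaluate (without g) Q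
    evaluate-without []             Q = sym (trans (+-identityʳ _) (zeroˡ _))
    evaluate-without ((a , e′) ∷ g) Q with e′ ≟ᵉ e
    ... | yes ≡.refl = begin
      a * w + evaluate g Q        ≈⟨ +-congˡ (evaluate-without g Q) ⟩
      a * w + (s * w + g₀)        ≈⟨ +-assoc _ _ _ ⟨
      a * w + s * w + g₀          ≈⟨ +-congʳ (distribʳ w a s) ⟨
      (a + s) * w + g₀            ∎
      where
      w = power Q e
      s = coefficient g e
      g₀ = evaluate (without g) Q
    ... | no _ = begin
      a * w + evaluate g Q         ≈⟨ +-congˡ (evaluate-without g Q) ⟩
      a * w + (s + g₀)             ≈⟨ CommutativeSemigroup.x∙yz≈y∙xz +-commutativeSemigroup _ _ _ ⟩
      s + (a * w + g₀)             ∎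
      where
      w = power Q e′
      s = coefficient g e * power Q e
      g₀ = evaluate (without g) Q

    coefficient-without-≡ : ∀ g → coefficient (without g) e ≈ 0#
    coefficient-without-≡ []             = refl
    coefficient-without-≡ ((a , e′) ∷ g) with e′ ≟ᵉ e in eq
    ... | yes _ = coefficient-without-≡ g
    ... | no  _ rewrite eq = coefficient-without-≡ g

    coefficient-without-≢ : ∀ g {e′} → ¬ e ≡ e′ →
      coefficient (without g) e′ ≈ coefficient g e′
    coefficient-without-≢ []              e≢e′ = refl
    coefficient-without-≢ ((a , e″) ∷ g) {e′} e≢e′ with e″ ≟ᵉ e
    coefficient-without-≢ ((a , e″) ∷ g) {e′} e≢e′ | yes ≡.refl with e″ ≟ᵉ e′
    ... | yes e≡e′ = contradiction e≡e′ e≢e′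
    ... | no  _    = coefficient-without-≢ g e≢e′
    coefficient-without-≢ ((a , e″) ∷ g) {e′} e≢e′ | no _ with e″ ≟ᵉ e′
    ... | yes _ = +-congˡ (coefficient-without-≢ g e≢e′)
    ... | no  _ = coefficient-without-≢ g e≢e′

  -- Split off the exponent of the first term: its total coefficient is zero, and what remains is
  -- null again but shorter. The remainder is not a syntactic part of `g`, hence the induction on a
  -- bound for the length.
  evaluate-null : ∀ {m} n (g : Polynomial m) → length g ≤ n → (∀ e → coefficient g e ≈ 0#) →
                  ∀ Q → evaluate g Q ≈ 0#
  evaluate-null n         []               _          g≈0 Q = refl
  evaluate-null (ℕ.suc n) g₀@((a , e) ∷ g) (ℕ.s≤s g≤n) g≈0 Q = begin
    evaluate g₀ Q
      ≈⟨ evaluate-without e g₀ Q ⟩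
    coefficient g₀ e * power Q e + evaluate (without e g₀) Q
      ≈⟨ +-cong (trans (*-congʳ (g≈0 e)) (zeroˡ _))
           (evaluate-null n (without e g₀) shorter null Q) ⟩
    0# + 0#
      ≈⟨ +-identityˡ 0# ⟩
    0# ∎
    where
    shorter : length (without e g₀) ≤ n
    shorter = ℕ.≤-trans (ℕ.≤-pred (List.filter-notAll (λ t → ¬? (proj₂ t ≟ᵉ e)) g₀
      (here λ e≢e → e≢e ≡.refl))) g≤n
    null : ∀ e′ → coefficient (without e g₀) e′ ≈ 0#
    null e′ with e ≟ᵉ e′
    ... | yes ≡.refl = coefficient-without-≡ e g₀
    ... | no  e≢e′   = trans (coefficient-without-≢ e g₀ e≢e′) (g≈0 e′)

  evaluate-≈ₚ : ∀ {m} (g h : Polynomial m) → g ≈ₚ h → ∀ Q → evaluate g Q ≈ evaluate h Q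
  evaluate-≈ₚ g h g≈h Q = x∙y⁻¹≈ε⇒x≈y _ _ (trans (sym (evaluate-⊖ g h Q))
    (evaluate-null _ (g ⊖ h) ℕ.≤-refl
      (λ e → trans (coefficient-⊖ g h e) (trans (+-congʳ (g≈h e)) (-‿inverseʳ _))) Q))

  -- Polynomials with bounded exponents as boxes of coefficients

  Box : ℕ → ℕ → ℕ → Set c
  Box L M N = Fin L → Fin M → Fin N → Carrier

  -- Nested with y outermost, so that roots can be counted first in y, then in x, then in z.
  value : ∀ {L M N} → Box L M N → 𝔸 3 → Carrier
  value A (x ∷ y ∷ z ∷ []) = poly (λ j → poly (λ i → poly (A i j) z) x) y

  value-cong : ∀ {L M N} {A B : Box L M N} Q → (∀ i j k → A i j k ≈ B i j k) →
               value A Q ≈ value B Q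
  value-cong (x ∷ y ∷ z ∷ []) A≈B =
    poly-cong (λ j → poly-cong (λ i → poly-cong (A≈B i j) refl) refl) refl

  sum-++ : ∀ m {n} (u : Vector Carrier (m ℕ.+ n)) →
           sum u ≈ sum (λ i → u (i ↑ˡ n)) + sum (λ j → u (m ↑ʳ j))
  sum-++ ℕ.zero    u = sym (+-identityˡ _)
  sum-++ (ℕ.suc m) u = trans (+-congˡ (sum-++ m (tail u))) (sym (+-assoc _ _ _))

  sum-combine : ∀ m {n} (u : Vector Carrier (m ℕ.* n)) →
                sum u ≈ ∑[ i < m ] ∑[ j < n ] u (combine i j)
  sum-combine ℕ.zero        u = refl
  sum-combine (ℕ.suc m) {n} u = trans (sum-++ n u) (+-congˡ (sum-combine m (λ i → u (n ↑ʳ i))))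

  module _ (L M N : ℕ) where

    exponents : Fin (L ℕ.* M ℕ.* N) → Fin L × Fin M × Fin N
    exponents r = let s , k = remQuot N r
                      i , j = remQuot M s
                  in i , j , k

    flatten : Fin L → Fin M → Fin N → Fin (L ℕ.* M ℕ.* N)
    flatten i j k = combine (combine i j) k

    exponents-flatten : ∀ i j k → exponents (flatten i j k) ≡ (i , j , k)
    exponents-flatten i j k = ≡.trans
      (≡.cong (λ (s , k) → let i , j = remQuot M s in i , j , k)
        (Fin.remQuot-combine (combine i j) k))
      (≡.cong (λ (i , j) → i , j , k) (Fin.remQuot-combine i j))

  boxMonomial : ∀ {L M N} → Fin L × Fin M × Fin N → Polynomial 3
  boxMonomial (i , j , k) = monomial (toℕ i ∷ toℕ j ∷ toℕ k ∷ [])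

  -- Translates the flat linear combinations of a basis into nested polynomials, where roots can be
  -- counted.
  sum-box : ∀ {L M N} (a : Vector Carrier (L ℕ.* M ℕ.* N)) Q →
    ∑[ r < L ℕ.* M ℕ.* N ] (a r * evaluate (boxMonomial (exponents L M N r)) Q)
      ≈ value (λ i j k → a (flatten L M N i j k)) Q
  sum-box {L} {M} {N} a Q@(x ∷ y ∷ z ∷ []) = begin
    ∑[ r < L ℕ.* M ℕ.* N ] term r
      ≈⟨ sum-combine (L ℕ.* M) term ⟩
    ∑[ s < L ℕ.* M ] ∑[ k < N ] term (combine s k)
      ≈⟨ sum-combine L (λ s → ∑[ k < N ] term (combine s k)) ⟩
    ∑[ i < L ] ∑[ j < M ] ∑[ k < N ] term (flatten L M N i j k)
      -- The flat index runs through x before y, whereas `value` has y outermost.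
      ≈⟨ ∑-comm (λ i j → ∑[ k < N ] term (flatten L M N i j k)) ⟩
    ∑[ j < M ] ∑[ i < L ] ∑[ k < N ] term (flatten L M N i j k)
      ≈⟨ sum-cong-≋ (λ j → sum-cong-≋ λ i → sum-cong-≋ λ k → term-flatten i j k) ⟩
    ∑[ j < M ] ∑[ i < L ] ∑[ k < N ] (A i j k * z ^ toℕ k * x ^ toℕ i * y ^ toℕ j)
      ≈⟨ sum-cong-≋ (λ j → sum-cong-≋ λ i →
           *-distribʳ-sum (y ^ toℕ j) (λ k → A i j k * z ^ toℕ k * x ^ toℕ i)) ⟨
    ∑[ j < M ] ∑[ i < L ] (∑[ k < N ] (A i j k * z ^ toℕ k * x ^ toℕ i) * y ^ toℕ j)
      ≈⟨ sum-cong-≋ (λ j → sum-cong-≋ λ i → *-congʳ (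
           *-distribʳ-sum (x ^ toℕ i) (λ k → A i j k * z ^ toℕ k))) ⟨
    ∑[ j < M ] ∑[ i < L ] (poly (A i j) z * x ^ toℕ i * y ^ toℕ j)
      ≈⟨ sum-cong-≋ (λ j → *-distribʳ-sum (y ^ toℕ j) (λ i → poly (A i j) z * x ^ toℕ i)) ⟨
    value A Q ∎
    where
    A : Box L M N
    A i j k = a (flatten L M N i j k)
    term : Vector Carrier (L ℕ.* M ℕ.* N)
    term r = a r * evaluate (boxMonomial (exponents L M N r)) Q
    term-flatten : ∀ i j k →
      term (flatten L M N i j k) ≈ A i j k * z ^ toℕ k * x ^ toℕ i * y ^ toℕ j
    term-flatten i j k = trans
        (*-congˡ (trans (reflexive (≡.cong (λ e → evaluate (boxMonomial e) Q)
          (exponents-flatten L M N i j k))) (trans (+-identityʳ _) (*-identityˡ _))))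
        (Solver.solve 4 (λ t u v w → t :* (u :* (v :* (w :* con 1))) := t :* w :* u :* v) refl
          (A i j k) (x ^ toℕ i) (y ^ toℕ j) (z ^ toℕ k))
      where open Solver using (_:*_; _:=_; con)

  coefficients : ∀ {L M N} → Polynomial 3 → Box L M N
  coefficients g i j k = coefficient g (toℕ i ∷ toℕ j ∷ toℕ k ∷ [])

  -- Each of the three nested sums has only one term that can be non-zero.
  value-boxMonomial : ∀ {L M N} (i : Fin L) (j : Fin M) (k : Fin N) Q →
    evaluate (boxMonomial (i , j , k)) Q
      ≈ value {L} {M} {N} (coefficients (boxMonomial (i , j , k))) Q
  value-boxMonomial {L} {M} {N} i j k (x ∷ y ∷ z ∷ []) = sym (begin
    poly (λ j′ → poly (λ i′ → poly (A i′ j′) z) x) y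
      ≈⟨ poly-single (λ j′ → poly (λ i′ → poly (A i′ j′) z) x) j y (λ j′ j′≢j →
           poly-0 {L} x λ i′ → poly-0 {N} z λ k′ → A≈0 i′ j′ k′ λ { (_ , j′≡j , _) → j′≢j j′≡j }) ⟩
    poly (λ i′ → poly (A i′ j) z) x * y ^ toℕ j
      ≈⟨ *-congʳ (poly-single (λ i′ → poly (A i′ j) z) i x (λ i′ i′≢i →
           poly-0 {N} z λ k′ → A≈0 i′ j k′ λ { (i′≡i , _) → i′≢i i′≡i })) ⟩
    poly (A i j) z * x ^ toℕ i * y ^ toℕ j
      ≈⟨ *-congʳ (*-congʳ (poly-single (A i j) k z (λ k′ k′≢k →
           A≈0 i j k′ λ { (_ , _ , k′≡k) → k′≢k k′≡k }))) ⟩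
    A i j k * z ^ toℕ k * x ^ toℕ i * y ^ toℕ j
      ≈⟨ *-congʳ (*-congʳ (*-congʳ (coefficient-monomial-≡ (toℕ i ∷ toℕ j ∷ toℕ k ∷ [])))) ⟩
    1# * z ^ toℕ k * x ^ toℕ i * y ^ toℕ j
      ≈⟨ Solver.solve 3 (λ u v w → con 1 :* w :* u :* v :=
           con 1 :* (u :* (v :* (w :* con 1))) :+ con 0) refl
           (x ^ toℕ i) (y ^ toℕ j) (z ^ toℕ k) ⟩
    1# * (x ^ toℕ i * (y ^ toℕ j * (z ^ toℕ k * 1#))) + 0# ∎)
    where
    open Solver using (_:*_; _:+_; _:=_; con)
    A : Box L M N
    A = coefficients (boxMonomial (i , j , k))
    A≈0 : ∀ i′ j′ k′ → ¬ (i′ ≡ i × j′ ≡ j × k′ ≡ k) → A i′ j′ k′ ≈ 0#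
    A≈0 i′ j′ k′ ≢ = coefficient-monomial-≢ (toℕ i ∷ toℕ j ∷ toℕ k ∷ [])
      (toℕ i′ ∷ toℕ j′ ∷ toℕ k′ ∷ []) λ eq → ≢
      ( ≡.sym (Fin.toℕ-injective (Vec.∷-injectiveˡ eq))
      , ≡.sym (Fin.toℕ-injective (Vec.∷-injectiveˡ (Vec.∷-injectiveʳ eq)))
      , ≡.sym (Fin.toℕ-injective (Vec.∷-injectiveˡ (Vec.∷-injectiveʳ (Vec.∷-injectiveʳ eq)))))

  module BoxSpace (l m n : ℕ) where

    InBox : Pred (Polynomial 3) _
    InBox = Span (polynomials 3) (BoxMonomial l m n)

    ⊖-closed : ∀ {g h} → InBox g → InBox h → InBox (g ⊖ h)
    ⊖-closed g∈V h∈V = by-+ g∈V (by-*ₗ (- 1#) h∈V)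

    private
      -- Exponents up to `l` mean `l + 1` coefficients.
      L = l ℕ.+ 1
      M = m ℕ.+ 1
      N = n ℕ.+ 1

      ≤⇒<+1 : ∀ {i l} → i ≤ l → i ℕ.< l ℕ.+ 1
      ≤⇒<+1 {l = l} i≤l = ℕ.≤-trans (ℕ.s≤s i≤l) (ℕ.≤-reflexive (ℕ.+-comm 1 l))

      toℕ≤ : ∀ {l L} → L ≤ l ℕ.+ 1 → (i : Fin L) → toℕ i ≤ l
      toℕ≤ {l} L≤l+1 i = ℕ.≤-pred (ℕ.≤-trans (Fin.toℕ<n i)
        (ℕ.≤-trans L≤l+1 (ℕ.≤-reflexive (ℕ.+-comm l 1))))

    -- Smaller boxes are allowed because bases of the punctured codes use only some of the
    -- monomials.
    boxMonomial∈ : ∀ {L′ M′ N′} → L′ ≤ L → M′ ≤ M → N′ ≤ N →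
                   (e : Fin L′ × Fin M′ × Fin N′) → InBox (boxMonomial e)
    boxMonomial∈ L′≤L M′≤M N′≤N (i , j , k) =
      by-∈ (xⁱyʲzᵏ (toℕ≤ L′≤L i) (toℕ≤ M′≤M j) (toℕ≤ N′≤N k))

    -- Induction on the derivation that `g` lies in the span; in the case `by-≈` evaluation has to
    -- be known to depend on the coefficients only.
    evaluate-box : ∀ {g} → InBox g → ∀ Q → evaluate g Q ≈ value {L} {M} {N} (coefficients g) Q
    evaluate-box (by-∈ (xⁱyʲzᵏ {i} {j} {k} i≤l j≤m k≤n)) Q
      with value-boxMonomial (fromℕ< (≤⇒<+1 i≤l)) (fromℕ< (≤⇒<+1 j≤m)) (fromℕ< (≤⇒<+1 k≤n)) Q
    ... | eq rewrite Fin.toℕ-fromℕ< (≤⇒<+1 i≤l) | Fin.toℕ-fromℕ< (≤⇒<+1 j≤m)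
                   | Fin.toℕ-fromℕ< (≤⇒<+1 k≤n) = eq
    evaluate-box (by-≈ {g} {h} g≈h g∈V) Q = trans (sym (evaluate-≈ₚ g h g≈h Q))
      (trans (evaluate-box g∈V Q) (value-cong {L} {M} {N} Q λ i j k → g≈h _))
    evaluate-box by-0 (x ∷ y ∷ z ∷ []) =
      sym (poly-0 {M} y λ j → poly-0 {L} x λ i → poly-0 {N} z λ k → refl)
    evaluate-box (by-+ {g} {h} g∈V h∈V) Q@(x ∷ y ∷ z ∷ []) = begin
      evaluate (g ++ h) Q
        ≈⟨ evaluate-++ g h Q ⟩
      evaluate g Q + evaluate h Q
        ≈⟨ +-cong (evaluate-box g∈V Q) (evaluate-box h∈V Q) ⟩
      value A Q + value B Q
        ≈⟨ poly-+ (λ j → poly (λ i → poly (A i j) z) x) (λ j → poly (λ i → poly (B i j) z) x) y ⟨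
      poly (λ j → poly (λ i → poly (A i j) z) x + poly (λ i → poly (B i j) z) x) y
        ≈⟨ poly-cong (λ j → poly-+ (λ i → poly (A i j) z) (λ i → poly (B i j) z) x) refl ⟨
      poly (λ j → poly (λ i → poly (A i j) z + poly (B i j) z) x) y
        ≈⟨ poly-cong (λ j → poly-cong (λ i → poly-+ (A i j) (B i j) z) refl) refl ⟨
      value (λ i j k → A i j k + B i j k) Q
        ≈⟨ value-cong {L} {M} {N} Q (λ i j k → coefficient-++ g h _) ⟨
      value {L} {M} {N} (coefficients (g ++ h)) Q ∎
      where
      A B : Box L M N
      A = coefficients g
      B = coefficients h
    evaluate-box (by-*ₗ b {g} g∈V) Q@(x ∷ y ∷ z ∷ []) = begin
      evaluate (scale b g) Q
        ≈⟨ evaluate-scale b g Q ⟩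
      b * evaluate g Q
        ≈⟨ *-congˡ (evaluate-box g∈V Q) ⟩
      b * value A Q
        ≈⟨ poly-* b (λ j → poly (λ i → poly (A i j) z) x) y ⟨
      poly (λ j → b * poly (λ i → poly (A i j) z) x) y
        ≈⟨ poly-cong (λ j → poly-* b (λ i → poly (A i j) z) x) refl ⟨
      poly (λ j → poly (λ i → b * poly (A i j) z) x) y
        ≈⟨ poly-cong (λ j → poly-cong (λ i → poly-* b (A i j) z) refl) refl ⟨
      value (λ i j k → b * A i j k) Q
        ≈⟨ value-cong {L} {M} {N} Q (λ i j k → coefficient-scale b g _) ⟨
      value {L} {M} {N} (coefficients (scale b g)) Q ∎
      where
      A : Box L M N
      A = coefficients g

    coefficient-outside : ∀ {g e} → InBox g →
      (∀ i j k → i ≤ l → j ≤ m → k ≤ n → ¬ i ∷ j ∷ k ∷ [] ≡ e) → coefficient g e ≈ 0#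
    coefficient-outside (by-∈ (xⁱyʲzᵏ i≤l j≤m k≤n)) e∉ =
      coefficient-monomial-≢ _ _ (e∉ _ _ _ i≤l j≤m k≤n)
    coefficient-outside (by-≈ g≈h g∈V) e∉ =
      trans (sym (g≈h _)) (coefficient-outside g∈V e∉)
    coefficient-outside by-0 e∉ = refl
    coefficient-outside (by-+ {g} {h} g∈V h∈V) e∉ = trans (coefficient-++ g h _) (trans
      (+-cong (coefficient-outside g∈V e∉) (coefficient-outside h∈V e∉)) (+-identityˡ 0#))
    coefficient-outside (by-*ₗ b {g} g∈V) e∉ = trans (coefficient-scale b g _)
      (trans (*-congˡ (coefficient-outside g∈V e∉)) (zeroʳ b))

    -- The box shows only exponents within the bounds; beyond them, membership in the span forces
    -- the coefficient to be zero.
    coefficients≈0⇒≈0 : ∀ {g} → InBox g →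
      (∀ i j k → coefficients {L} {M} {N} g i j k ≈ 0#) → ∀ e → coefficient g e ≈ 0#
    coefficients≈0⇒≈0 {g} g∈V A≈0 e@(i ∷ j ∷ k ∷ []) with i ℕ.≤? l | j ℕ.≤? m | k ℕ.≤? n
    ... | yes i≤l | yes j≤m | yes k≤n
      with A≈0 (fromℕ< (≤⇒<+1 i≤l)) (fromℕ< (≤⇒<+1 j≤m)) (fromℕ< (≤⇒<+1 k≤n))
    ... | eq rewrite Fin.toℕ-fromℕ< (≤⇒<+1 i≤l) | Fin.toℕ-fromℕ< (≤⇒<+1 j≤m)
                   | Fin.toℕ-fromℕ< (≤⇒<+1 k≤n) = eq
    coefficients≈0⇒≈0 g∈V A≈0 e | no i≰l | _ | _ =
      coefficient-outside g∈V λ { i j k i≤l _ _ ≡.refl → i≰l i≤l }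
    coefficients≈0⇒≈0 g∈V A≈0 e | _ | no j≰m | _ =
      coefficient-outside g∈V λ { i j k _ j≤m _ ≡.refl → j≰m j≤m }
    coefficients≈0⇒≈0 g∈V A≈0 e | _ | _ | no k≰n =
      coefficient-outside g∈V λ { i j k _ _ k≤n ≡.refl → k≰n k≤n }

  -- Characteristic p and the prime field

  -- Adding 1 permutes the field, so the sum of all elements is unchanged by adding q · 1.
  q·1≈0 : q · 1# ≈ 0#
  q·1≈0 = sym (∙-cancelˡ (sum element) _ _ (begin
    sum element + 0#             ≈⟨ +-identityʳ _ ⟩
    sum element                  ≈⟨ ∑-permute element shift ⟩
    sum (λ k → element (up k))   ≈⟨ sum-cong-≋ {q} (λ k → element-index (element k + 1#)) ⟩
    sum (λ k → element k + 1#)   ≈⟨ ∑-distrib-+ element (λ _ → 1#) ⟩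
    sum element + sum {q} (λ _ → 1#) ≈⟨ +-congˡ (sum-replicate q) ⟩
    sum element + q · 1#         ∎))
    where
    open Bijection enumeration using () renaming (to to element; to⁻ to index)
    element-index : ∀ x → element (index x) ≈ x
    element-index x = proj₂ (Bijection.strictlySurjective enumeration x)
    up down : Fin q → Fin q
    up   k = index (element k + 1#)
    down k = index (element k - 1#)
    shift : Permutation q q
    shift = permutation up down
      (λ k → Bijection.injective enumeration (begin
        element (up (down k))     ≈⟨ element-index _ ⟩
        element (down k) + 1#     ≈⟨ +-congʳ (element-index _) ⟩
        element k - 1# + 1#       ≈⟨ //-rightDividesˡ 1# _ ⟩
        element k                 ∎))
      (λ k → Bijection.injective enumeration (begin
        element (down (up k))     ≈⟨ element-index _ ⟩
        element (up k) - 1#       ≈⟨ +-congʳ (element-index _) ⟩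
        element k + 1# - 1#       ≈⟨ +-assoc _ _ _ ⟩
        element k + (1# - 1#)     ≈⟨ +-congˡ (-‿inverseʳ 1#) ⟩
        element k + 0#            ≈⟨ +-identityʳ _ ⟩
        element k                 ∎))

  -- If `m · 1#` were non-zero, the factors of the power could be cancelled one at a time, ending in
  -- 1 = 0.
  ^·1≈0⇒·1≈0 : ∀ m h → (m ℕ.^ h) · 1# ≈ 0# → m · 1# ≈ 0#
  ^·1≈0⇒·1≈0 m ℕ.zero    1·1≈0 = contradiction (trans (sym 1·1≈0) (+-identityʳ 1#)) 0≉1
  ^·1≈0⇒·1≈0 m (ℕ.suc h) m^h·1≈0 with m · 1# ≟ 0#
  ... | yes m·1≈0 = m·1≈0
  ... | no  m·1≉0 = ^·1≈0⇒·1≈0 m h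
    (x*y≈0⇒y≈0 m·1≉0 (trans (sym (×1-homo-* m (m ℕ.^ h))) m^h·1≈0))

  module Characteristic {p} (pPrime : Prime p) (p·1≈0 : p · 1# ≈ 0#) where

    p∣m⇒m·x≈0 : ∀ {m} → p ∣ m → ∀ x → m · x ≈ 0#
    p∣m⇒m·x≈0 (divides k ≡.refl) x = begin
      (k ℕ.* p) · x       ≈⟨ ×-congʳ (k ℕ.* p) (*-identityˡ x) ⟨
      (k ℕ.* p) · (1# * x) ≈⟨ ×-assoc-* (k ℕ.* p) 1# x ⟨
      (k ℕ.* p) · 1# * x  ≈⟨ *-congʳ (×1-homo-* k p) ⟩
      k · 1# * (p · 1#) * x ≈⟨ *-congʳ (trans (*-congˡ p·1≈0) (zeroʳ _)) ⟩
      0# * x              ≈⟨ zeroˡ x ⟩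
      0#                  ∎

    frobenius : ∀ x y → (x + y) ^ p ≈ x ^ p + y ^ p
    frobenius x y = go p ≡.refl
      where
      -- A separate `n` can be matched as a successor, which lets the two outer terms of the
      -- binomial sum be split off.
      go : ∀ n → n ≡ p → (x + y) ^ n ≈ x ^ n + y ^ n
      go ℕ.zero      0≡p = contradiction (≡.sym 0≡p) (ℕ.≢-nonZero⁻¹ p {{prime⇒nonZero pPrime}})
      go n@(ℕ.suc m) ≡.refl = begin
        (x + y) ^ n
          ≈⟨ Binomial.theorem n x y ⟩
        term zero + ∑[ k < n ] term (suc k)
          ≈⟨ +-congˡ (sum-init-last (term ∘ suc)) ⟩
        term zero + (∑[ k < m ] term (suc (inject₁ k)) + term (fromℕ n))
          ≈⟨ +-congˡ (+-congʳ (trans (sum-cong-≋ middle) (sum-replicate-zero m))) ⟩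
        term zero + (0# + term (fromℕ n))
          ≈⟨ +-cong first (trans (+-identityˡ _) last) ⟩
        y ^ n + x ^ n
          ≈⟨ +-comm _ _ ⟩
        x ^ n + y ^ n ∎
        where
        term : Vector Carrier (ℕ.suc n)
        term = Binomial.binomialTerm x y n
        first : term zero ≈ y ^ n
        first = trans (+-identityʳ _) (*-identityˡ _)
        last : term (fromℕ n) ≈ x ^ n
        last = begin
          (n choose toℕ (fromℕ n)) · (x ^ toℕ (fromℕ n) * y ^ (n ∸ toℕ (fromℕ n)))
            ≡⟨ ≡.cong (λ k → (n choose k) · (x ^ k * y ^ (n ∸ k))) (Fin.toℕ-fromℕ n) ⟩
          (n choose n) · (x ^ n * y ^ (n ∸ n))
            ≈⟨ ×-cong (nCn≡1 n) (*-congˡ (^-congʳ y (ℕ.n∸n≡0 n))) ⟩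
          1 · (x ^ n * 1#)
            ≈⟨ trans (+-identityʳ _) (*-identityʳ _) ⟩
          x ^ n ∎
        middle : ∀ k → term (suc (inject₁ k)) ≈ 0#
        middle k = p∣m⇒m·x≈0 (prime∣choose pPrime (ℕ.s≤s ℕ.z≤n)
          (ℕ.s≤s (ℕ.≤-trans (ℕ.≤-reflexive (≡.cong ℕ.suc (Fin.toℕ-inject₁ k))) (Fin.toℕ<n k)))) _

    1^n≈1 : ∀ n → 1# ^ n ≈ 1#
    1^n≈1 ℕ.zero    = refl
    1^n≈1 (ℕ.suc n) = trans (*-identityˡ _) (1^n≈1 n)

    0^p≈0 : 0# ^ p ≈ 0#
    0^p≈0 = ∙-cancelˡ (0# ^ p) _ _ (begin
      0# ^ p + 0# ^ p  ≈⟨ frobenius 0# 0# ⟨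
      (0# + 0#) ^ p    ≈⟨ ^-congˡ p (+-identityˡ 0#) ⟩
      0# ^ p           ≈⟨ +-identityʳ _ ⟨
      0# ^ p + 0#      ∎)

    -- Fermat's little theorem by induction: the p-th power commutes with adding 1.
    prime-subfield : ∀ m → (m · 1#) ^ p ≈ m · 1#
    prime-subfield ℕ.zero    = 0^p≈0
    prime-subfield (ℕ.suc m) = trans (frobenius 1# (m · 1#)) (+-cong (1^n≈1 p) (prime-subfield m))

    -- A positive `m` below `p` is coprime to it, so by Bézout multiples of `m` and `p` differ by 1;
    -- both would be zero in the field.
    m·1≈0⇒m≡0 : ∀ {m} → m ℕ.< p → m · 1# ≈ 0# → m ≡ 0
    m·1≈0⇒m≡0 {ℕ.zero}      _   _     = ≡.refl
    m·1≈0⇒m≡0 {m@(ℕ.suc _)} m<p m·1≈0 =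
      absurd (coprime-Bézout (prime⇒coprime pPrime m<p))
      where
      multiple≈0 : ∀ k {n} → n · 1# ≈ 0# → (k ℕ.* n) · 1# ≈ 0#
      multiple≈0 k {n} n·1≈0 = trans (×1-homo-* k n) (trans (*-congˡ n·1≈0) (zeroʳ _))
      one≈0 : ∀ u v → 1 ℕ.+ u ≡ v → u · 1# ≈ 0# → v · 1# ≈ 0# → 0# ≈ 1#
      one≈0 u v ≡.refl u≈0 v≈0 = trans (sym v≈0) (trans (+-congˡ u≈0) (+-identityʳ 1#))
      absurd : GCD.Bézout.Identity 1 p m → _
      absurd (GCD.Bézout.+- x y eq) = contradiction
        (one≈0 (y ℕ.* m) (x ℕ.* p) eq (multiple≈0 y m·1≈0) (multiple≈0 x p·1≈0)) 0≉1
      absurd (GCD.Bézout.-+ x y eq) = contradiction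
        (one≈0 (x ℕ.* p) (y ℕ.* m) eq (multiple≈0 x p·1≈0) (multiple≈0 y m·1≈0)) 0≉1

    prime-subfield-distinct : Distinct (λ (δ : Fin p) → toℕ δ · 1#)
    prime-subfield-distinct {i} {j} eq = Fin.toℕ-injective
      ([ (λ i≤j → ≤-case i≤j (Fin.toℕ<n j) eq)
       , (λ j≤i → ≡.sym (≤-case j≤i (Fin.toℕ<n i) (sym eq))) ]′ (ℕ.≤-total (toℕ i) (toℕ j)))
      where
      ≤-case : ∀ {m n} → m ≤ n → n ℕ.< p → m · 1# ≈ n · 1# → m ≡ n
      ≤-case {m} {n} m≤n n<p m≈n = ℕ.≤-antisym m≤n (ℕ.m∸n≡0⇒m≤n
        (m·1≈0⇒m≡0 (ℕ.≤-<-trans (ℕ.m∸n≤m n m) n<p) (∙-cancelʳ (m · 1#) _ _ (begin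
          (n ∸ m) · 1# + m · 1#  ≈⟨ ×-homo-+ 1# (n ∸ m) m ⟨
          (n ∸ m ℕ.+ m) · 1#     ≈⟨ ×-congˡ (ℕ.m∸n+n≡m m≤n) ⟩
          n · 1#                 ≈⟨ m≈n ⟨
          m · 1#                 ≈⟨ +-identityˡ _ ⟨
          0# + m · 1#            ∎))))

    -- Otherwise x and the prime subfield are p + 1 roots of t^p - t.
    x^p≈x⇒prime-subfield : ∀ {x} → x ^ p ≈ x → ∃[ δ ] x ≈ toℕ {p} δ · 1#
    x^p≈x⇒prime-subfield {x} x^p≈x with Fin.any? (λ δ → x ≟ toℕ {p} δ · 1#)
    ... | yes x∈ = x∈
    ... | no  x∉ = contradiction
      (trans (sym (roots⇒0 a roots distinct a[roots]≈0 (fromℕ p))) a[p]≈1) 0≉1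
      where
      1<p : 1 ℕ.< p
      1<p = ℕ.nonTrivial⇒n>1 p {{prime⇒nonTrivial pPrime}}
      one : Fin (ℕ.suc p)
      one = fromℕ< (ℕ.m≤n⇒m≤1+n 1<p)
      single : Fin (ℕ.suc p) → Carrier → Vector Carrier (ℕ.suc p)
      single k s i = if does (i Fin.≟ k) then s else 0#
      single-≡ : ∀ k s → single k s k ≈ s
      single-≡ k s with k Fin.≟ k
      ... | yes _   = refl
      ... | no  k≢k = contradiction ≡.refl k≢k
      single-≢ : ∀ k s i → ¬ i ≡ k → single k s i ≈ 0#
      single-≢ k s i i≢k with i Fin.≟ k
      ... | yes i≡k = contradiction i≡k i≢k
      ... | no  _   = refl
      poly-single′ : ∀ k s t → poly (single k s) t ≈ s * t ^ toℕ k
      poly-single′ k s t =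
        trans (poly-single (single k s) k t (single-≢ k s)) (*-congʳ (single-≡ k s))
      a : Vector Carrier (ℕ.suc p)
      a i = single (fromℕ p) 1# i + single one (- 1#) i
      a[p]≈1 : a (fromℕ p) ≈ 1#
      a[p]≈1 = trans (+-cong (single-≡ (fromℕ p) 1#) (single-≢ one (- 1#) (fromℕ p) p≢1))
        (+-identityʳ 1#)
        where
        p≢1 : ¬ fromℕ p ≡ one
        p≢1 eq = ℕ.<⇒≢ 1<p (≡.trans (≡.sym (Fin.toℕ-fromℕ< (ℕ.m≤n⇒m≤1+n 1<p)))
          (≡.trans (≡.cong toℕ (≡.sym eq)) (Fin.toℕ-fromℕ p)))
      poly-a : ∀ t → t ^ p ≈ t → poly a t ≈ 0#
      poly-a t t^p≈t = begin
        poly a t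
          ≈⟨ poly-+ (single (fromℕ p) 1#) (single one (- 1#)) t ⟩
        poly (single (fromℕ p) 1#) t + poly (single one (- 1#)) t
          ≈⟨ +-cong (poly-single′ (fromℕ p) 1# t) (poly-single′ one (- 1#) t) ⟩
        1# * t ^ toℕ (fromℕ p) + - 1# * t ^ toℕ one
          ≈⟨ +-cong (*-identityˡ _) (-1*x≈-x _) ⟩
        t ^ toℕ (fromℕ p) - t ^ toℕ one
          ≈⟨ +-cong (^-congʳ t (Fin.toℕ-fromℕ p))
               (-‿cong (^-congʳ t (Fin.toℕ-fromℕ< (ℕ.m≤n⇒m≤1+n 1<p)))) ⟩
        t ^ p - t ^ 1
          ≈⟨ +-cong t^p≈t (-‿cong (*-identityʳ t)) ⟩
        t - t
          ≈⟨ -‿inverseʳ t ⟩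
        0# ∎
      roots : Vector Carrier (ℕ.suc p)
      roots zero    = x
      roots (suc δ) = toℕ δ · 1#
      distinct : Distinct roots
      distinct {zero}  {zero}  _  = ≡.refl
      distinct {zero}  {suc δ} eq = contradiction (δ , eq) x∉
      distinct {suc δ} {zero}  eq = contradiction (δ , sym eq) x∉
      distinct {suc δ} {suc ε} eq = ≡.cong suc (prime-subfield-distinct eq)
      a[roots]≈0 : ∀ k → poly a (roots k) ≈ 0#
      a[roots]≈0 zero    = poly-a x x^p≈x
      a[roots]≈0 (suc δ) = poly-a (toℕ δ · 1#) (prime-subfield (toℕ δ))

  -- Counting zeros on triangular grids

  value-cong-point : ∀ {L M N} (A : Box L M N) {Q R} → Q ≈ₐ R → value A Q ≈ value A R
  value-cong-point {L} {M} {N} A {_ ∷ _ ∷ _ ∷ []} {_ ∷ _ ∷ _ ∷ []} (x≈ ∷ y≈ ∷ z≈ ∷ []) =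
    poly-cong {M} (λ j → poly-cong {L} (λ i → poly-cong {N} (λ k → refl) z≈) x≈) y≈

  -- For fixed z and x, the roots in y kill the coefficients of all powers of y. These are
  -- polynomials in x, so the values of x kill their coefficients, which are polynomials in z.
  grid⇒0 : ∀ {L M N X Y Z} → L ≤ X → M ≤ Y → N ≤ Z → (A : Box L M N)
    (zs : Vector Carrier Z) (xs : Fin Z → Vector Carrier X)
    (ys : Fin Z → Fin X → Vector Carrier Y) →
    Distinct zs → (∀ t → Distinct (xs t)) → (∀ t s → Distinct (ys t s)) →
    (∀ t s u → value A (xs t s ∷ ys t s u ∷ zs t ∷ []) ≈ 0#) → ∀ i j k → A i j k ≈ 0#
  grid⇒0 L≤X M≤Y N≤Z A zs xs ys zs-distinct xs-distinct ys-distinct A≈0 i j =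
    roots≤⇒0 (A i j) zs N≤Z zs-distinct λ t →
    roots≤⇒0 (λ i → poly (A i j) (zs t)) (xs t) L≤X (xs-distinct t) (λ s →
    roots≤⇒0 (λ j → poly (λ i → poly (A i j) (zs t)) (xs t s)) (ys t s) M≤Y (ys-distinct t s)
      (A≈0 t s) j) i

  poly-1 : ∀ (a : Vector Carrier 1) x → poly a x ≈ a zero
  poly-1 a x = trans (+-identityʳ _) (*-identityʳ _)

  -- `nonroots` is applied twice: a non-zero coefficient of a power of y survives at `r₁` values of
  -- x, and above each of them the polynomial in y is non-zero at `r₂` places. The witness `Q` may
  -- lie off the grid; it serves to produce a non-zero coefficient.
  grid-weight : ∀ {L M X Y} r₁ r₂ → r₁ ℕ.+ L ≤ ℕ.suc X → r₂ ℕ.+ M ≤ ℕ.suc Y → (A : Box L M 1)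
    (xs : Vector Carrier X) (ys : Fin X → Vector Carrier Y) (z : Carrier) →
    Distinct xs → (∀ s → Distinct (ys s)) → ∃[ Q ] value A Q ≉ 0# →
    ∃[ φ ] (Injective _≡_ _≡_ φ × (∀ (k : Fin (r₁ ℕ.* r₂)) →
      value A (xs (proj₁ (φ k)) ∷ ys (proj₁ (φ k)) (proj₂ (φ k)) ∷ z ∷ []) ≉ 0#))
  grid-weight {L} {M} {X} {Y} r₁ r₂ r₁+L≤1+X r₂+M≤1+Y A xs ys z xs-distinct ys-distinct
    (x ∷ y ∷ z′ ∷ [] , A[Q]≉0)
    with j , aⱼ≉0  ← poly≉0⇒coefficient≉0 (λ j → poly (λ i → poly (A i j) z′) x) y A[Q]≉0
    with i , aᵢⱼ≉0 ← poly≉0⇒coefficient≉0 (λ i → poly (A i j) z′) x aⱼ≉0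
    with φ₁ , φ₁-injective , φ₁≉0 ← nonroots (λ i → poly (A i j) z) xs r₁ xs-distinct r₁+L≤1+X
           -- Degree 0 in z makes the coefficient the same at `z′` and at `z`.
           (i , aᵢⱼ≉0 ∘ trans (trans (poly-1 (A i j) z′) (sym (poly-1 (A i j) z))))
    = φ , φ-injective , λ k → proj₂ (proj₂ (row (quot k))) (rem k)
    where
    quot : Fin (r₁ ℕ.* r₂) → Fin r₁
    quot k = proj₁ (remQuot r₂ k)
    rem : Fin (r₁ ℕ.* r₂) → Fin r₂
    rem k = proj₂ (remQuot {r₁} r₂ k)
    row : ∀ k → ∃[ φ₂ ] (Injective _≡_ _≡_ φ₂ × (∀ (m : Fin r₂) →
            value A (xs (φ₁ k) ∷ ys (φ₁ k) (φ₂ m) ∷ z ∷ []) ≉ 0#))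
    row k = nonroots (λ j → poly (λ i → poly (A i j) z) (xs (φ₁ k))) (ys (φ₁ k)) r₂
      (ys-distinct (φ₁ k)) r₂+M≤1+Y (j , φ₁≉0 k)
    φ : Fin (r₁ ℕ.* r₂) → Fin X × Fin Y
    φ k = φ₁ (quot k) , proj₁ (row (quot k)) (rem k)
    -- The choice in y depends on the chosen x, so the x-indices are identified before the y-indices
    -- can be compared.
    pair-injective : ∀ {k k′ m m′} →
      φ₁ k ≡ φ₁ k′ → proj₁ (row k) m ≡ proj₁ (row k′) m′ → combine k m ≡ combine k′ m′
    pair-injective {k} eq₁ eq₂ with φ₁-injective eq₁
    ... | ≡.refl = ≡.cong (combine k) (proj₁ (proj₂ (row k)) eq₂)
    φ-injective : Injective _≡_ _≡_ φ
    φ-injective {k} {k′} eq = ≡.trans (≡.sym (Fin.combine-remQuot {r₁} r₂ k))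
      (≡.trans (pair-injective (≡.cong proj₁ eq) (≡.cong proj₂ eq))
        (Fin.combine-remQuot {r₁} r₂ k′))

  -- Monomials as a basis of a code

  linearCombination-sum : ∀ {n d} (a : Vector Carrier d) (b : Vector (Vector Carrier n) d) k →
    linearCombination (𝔽^ n) a b k ≈ ∑[ r < d ] (a r * b r k)
  linearCombination-sum {d = ℕ.zero}  a b k = refl
  linearCombination-sum {d = ℕ.suc d} a b k = +-congˡ (linearCombination-sum (tail a) (tail b) k)

  flatten-exponents : ∀ L M N r → uncurry (λ i → uncurry (flatten L M N i)) (exponents L M N r) ≡ r
  flatten-exponents L M N r = ≡.trans
    (≡.cong (λ s → combine s (proj₂ (remQuot {L ℕ.* M} N r)))
      (Fin.combine-remQuot {L} M (proj₁ (remQuot N r))))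
    (Fin.combine-remQuot {L ℕ.* M} N r)

  -- Serves the full code and its puncturings alike: every codeword is the table of values of a box,
  -- and a vanishing table forces a vanishing box, so boxes are coordinates.
  monomialBasis : ∀ {n} (W : LinearCode n) (R : Vector (𝔸 3) n) L M N →
    (∀ (e : Fin L × Fin M × Fin N) → Subspace.Member W (evaluations R (boxMonomial e))) →
    (∀ w → Subspace.Member W w → ∃[ A ] (∀ k → w k ≈ value {L} {M} {N} A (R k))) →
    (∀ A → (∀ k → value {L} {M} {N} A (R k) ≈ 0#) → ∀ i j k → A i j k ≈ 0#) →
    HasDimension W (L ℕ.* M ℕ.* N)
  monomialBasis W R L M N members values value≈0⇒≈0 = record
    { vectors     = vectors
    ; members     = λ r → members (exponents L M N r)
    ; independent = λ a a≈0 r → trans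
        (reflexive (≡.cong a (≡.sym (flatten-exponents L M N r))))
        (value≈0⇒≈0 (λ i j k → a (flatten L M N i j k))
          (λ k → trans (sym (combination a k)) (a≈0 k)) _ _ _)
    ; spanning    = λ w w∈W → let A , w≈A = values w w∈W in
        coordinates A , λ k → begin
          w k
            ≈⟨ w≈A k ⟩
          value A (R k)
            ≈⟨ value-cong {L} {M} {N} (R k) (λ i j m → reflexive (≡.cong
                 (λ (i , j , m) → A i j m) (≡.sym (exponents-flatten L M N i j m)))) ⟩
          value (λ i j m → coordinates A (flatten L M N i j m)) (R k)
            ≈⟨ combination (coordinates A) k ⟨
          linearCombination (𝔽^ _) (coordinates A) vectors k ∎
    }
    where
    vectors : Vector (Vector Carrier _) (L ℕ.* M ℕ.* N)
    vectors r = evaluations R (boxMonomial (exponents L M N r))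
    coordinates : Box L M N → Vector Carrier (L ℕ.* M ℕ.* N)
    coordinates A r = uncurry (λ i → uncurry (A i)) (exponents L M N r)
    combination : ∀ a k → linearCombination (𝔽^ _) a vectors k
                          ≈ value (λ i j m → a (flatten L M N i j m)) (R k)
    combination a k = trans (linearCombination-sum a vectors k) (sum-box {L} {M} {N} a (R k))

  -- Points of the surface and of its plane sections

  module SurfacePoints {p} (pPrime : Prime p) (p·1≈0 : p · 1# ≈ 0#) (f : Polynomial 2) where

    open Characteristic pPrime p·1≈0
    open Surface p f

    evaluate-negate : ∀ {m} (g : Polynomial m) Q → evaluate (negate g) Q ≈ - evaluate g Q
    evaluate-negate []            Q = sym -0#≈0#
    evaluate-negate ((a , e) ∷ g) Q = trans
      (+-cong (sym (-‿distribˡ-* a _)) (evaluate-negate g Q)) (⁻¹-∙-comm _ _)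

    -- The map inside `surface` is an anonymous pattern-matching function, so it is represented by a
    -- variable `φ` known only through its values.
    evaluate-embed : ∀ (φ : Carrier × Vec ℕ 2 → Carrier × Vec ℕ 3) →
      (∀ a i k → φ (a , i ∷ k ∷ []) ≡ (a , i ∷ 0 ∷ k ∷ [])) → ∀ (g : Polynomial 2) x y z →
      evaluate (map φ g) (x ∷ y ∷ z ∷ []) ≈ evaluate g (x ∷ z ∷ [])
    evaluate-embed φ φ≡ []                        x y z = refl
    evaluate-embed φ φ≡ ((a , i ∷ k ∷ []) ∷ g) x y z rewrite φ≡ a i k =
      +-cong (*-congˡ (*-congˡ (*-identityˡ _))) (evaluate-embed φ φ≡ g x y z)

    F : Carrier → Carrier → Carrier
    F x z = evaluate f (x ∷ z ∷ [])

    evaluate-surface : ∀ x y z → evaluate surface (x ∷ y ∷ z ∷ []) ≈ y ^ p - (y + F x z)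
    evaluate-surface x y z = +-cong
      (trans (*-identityˡ _) (trans (*-identityˡ _)
        (trans (*-congˡ (*-identityˡ 1#)) (*-identityʳ _))))
      (trans (+-cong
        (trans (-1*x≈-x _) (-‿cong (trans (*-identityˡ _)
          (trans (*-congˡ (*-identityˡ 1#)) (trans (*-identityʳ _) (*-identityʳ y))))))
        (trans (evaluate-negate (map _ f) (x ∷ y ∷ z ∷ []))
          (-‿cong (evaluate-embed _ (λ _ _ _ → ≡.refl) f x y z))))
        (⁻¹-∙-comm y (F x z)))

    𝒮⁺ : ∀ {x y z} → y ^ p ≈ y + F x z → 𝒮 (x ∷ y ∷ z ∷ [])
    𝒮⁺ eq = trans (evaluate-surface _ _ _) (x≈y⇒x∙y⁻¹≈ε eq) ∷ []

    𝒮⁻ : ∀ {x y z} → 𝒮 (x ∷ y ∷ z ∷ []) → y ^ p ≈ y + F x z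
    𝒮⁻ (eq ∷ []) = x∙y⁻¹≈ε⇒x≈y _ _ (trans (sym (evaluate-surface _ _ _)) eq)

    𝒮-cong : ∀ Q R → Q ≈ₐ R → 𝒮 Q → 𝒮 R
    𝒮-cong _ _ Q≈R (eq ∷ []) = trans (sym (evaluate-cong surface Q≈R)) eq ∷ []

    evaluate-plane : ∀ x y z γ →
      evaluate (monomial (0 ∷ 0 ∷ 1 ∷ []) ++ negate (constant γ)) (x ∷ y ∷ z ∷ []) ≈ z - γ
    evaluate-plane x y z γ = +-cong
      (trans (*-identityˡ _) (trans (*-identityˡ _) (trans (*-identityˡ _)
        (trans (*-identityʳ _) (*-identityʳ z)))))
      (trans (+-identityʳ _) (trans (*-congˡ (trans (*-identityˡ _) (trans (*-identityˡ _)
        (*-identityˡ 1#)))) (*-identityʳ _)))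

    𝒵⁺ : ∀ {γ} Q → 𝒮 Q → πz Q ≈ γ → 𝒵 γ Q
    𝒵⁺ {γ} (x ∷ y ∷ z ∷ []) (eq ∷ []) z≈γ =
      eq ∷ trans (evaluate-plane x y z γ) (x≈y⇒x∙y⁻¹≈ε z≈γ) ∷ []

    𝒵⁻ : ∀ {γ} Q → 𝒵 γ Q → 𝒮 Q × πz Q ≈ γ
    𝒵⁻ {γ} (x ∷ y ∷ z ∷ []) (eq ∷ eq′ ∷ []) =
      (eq ∷ []) , x∙y⁻¹≈ε⇒x≈y _ _ (trans (sym (evaluate-plane x y z γ)) eq′)

    coefficient-map-cong : ∀ {m n} (φ ψ : Carrier × Vec ℕ m → Carrier × Vec ℕ n) →
      (∀ t → proj₁ (φ t) ≈ proj₁ (ψ t) × proj₂ (φ t) ≡ proj₂ (ψ t)) →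
      ∀ g → map φ g ≈ₚ map ψ g
    coefficient-map-cong φ ψ φ≈ψ []      e = refl
    coefficient-map-cong φ ψ φ≈ψ (t ∷ g) e with φ t | ψ t | φ≈ψ t
    ... | a , e′ | b , _ | a≈b , ≡.refl with e′ ≟ᵉ e
    ...   | yes _ = +-cong a≈b (coefficient-map-cong φ ψ φ≈ψ g e)
    ...   | no  _ = coefficient-map-cong φ ψ φ≈ψ g e

    section-cong : ∀ {γ γ′} → γ ≈ γ′ → section γ ≈ₚ section γ′
    section-cong γ≈γ′ = coefficient-map-cong _ _
      (λ { (a , i ∷ k ∷ []) → *-congˡ (^-congˡ k γ≈γ′) , ≡.refl }) f

    -- A point of `𝒵 γ` has a z-coordinate that is merely `≈ γ`, while `T` tests `Γ` at that
    -- coordinate.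
    Γ-cong : ∀ {η γ γ′} → γ ≈ γ′ → Γ η γ → Γ η γ′
    Γ-cong {γ = γ} {γ′} γ≈γ′ (nonconstant , m , size , η≤m) =
      (λ (a , eq) → nonconstant (a , λ e → trans (section-cong γ≈γ′ e) (eq e))) ,
      m , HasSize-⇔ (λ (Q , Q∈ , eq) → Q , move Q γ≈γ′ Q∈ , eq)
                    (λ (Q , Q∈ , eq) → Q , move Q (sym γ≈γ′) Q∈ , eq) size , η≤m
      where
      move : ∀ {γ γ′} Q → γ ≈ γ′ → 𝒵 γ Q → 𝒵 γ′ Q
      move Q γ≈γ′ Q∈ with Q∈𝒮 , z≈γ ← 𝒵⁻ Q Q∈ = 𝒵⁺ Q Q∈𝒮 (trans z≈γ γ≈γ′)

    -- Adding an element fixed by the p-th power changes both sides of `y ^ p ≈ y + F x z` by the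
    -- same amount.
    𝒮-fibre : ∀ {x y z} m → 𝒮 (x ∷ y ∷ z ∷ []) → 𝒮 (x ∷ y + m · 1# ∷ z ∷ [])
    𝒮-fibre {x} {y} {z} m Q∈𝒮 = 𝒮⁺ (begin
      (y + t) ^ p        ≈⟨ frobenius y t ⟩
      y ^ p + t ^ p      ≈⟨ +-cong (𝒮⁻ Q∈𝒮) (prime-subfield m) ⟩
      y + F x z + t      ≈⟨ +-assoc _ _ _ ⟩
      y + (F x z + t)    ≈⟨ +-congˡ (+-comm _ _) ⟩
      y + (t + F x z)    ≈⟨ +-assoc _ _ _ ⟨
      y + t + F x z      ∎)
      where t = m · 1#

    -- Subtracting the two equations shows that the difference `t` of the y-coordinates satisfies
    -- `t ^ p ≈ t`, which only elements of the prime field do.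
    𝒮-fibre-complete : ∀ {x y z y′} → 𝒮 (x ∷ y ∷ z ∷ []) → 𝒮 (x ∷ y′ ∷ z ∷ []) →
                       ∃[ δ ] y′ ≈ y + toℕ {p} δ · 1#
    𝒮-fibre-complete {x} {y} {z} {y′} Q∈𝒮 Q′∈𝒮 =
      map₂ (λ t≈δ → trans (sym y+t≈y′) (+-congˡ t≈δ))
      (x^p≈x⇒prime-subfield (∙-cancelˡ (y ^ p) _ _ (begin
        y ^ p + t ^ p    ≈⟨ frobenius y t ⟨
        (y + t) ^ p      ≈⟨ ^-congˡ p y+t≈y′ ⟩
        y′ ^ p           ≈⟨ 𝒮⁻ Q′∈𝒮 ⟩
        y′ + F x z       ≈⟨ +-congʳ y+t≈y′ ⟨
        y + t + F x z    ≈⟨ +-assoc _ _ _ ⟩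
        y + (t + F x z)  ≈⟨ +-congˡ (+-comm _ _) ⟩
        y + (F x z + t)  ≈⟨ +-assoc _ _ _ ⟨
        y + F x z + t    ≈⟨ +-congʳ (𝒮⁻ Q∈𝒮) ⟨
        y ^ p + t        ∎)))
      where
      t = y′ - y
      y+t≈y′ : y + t ≈ y′
      y+t≈y′ = trans (+-comm y t) (//-rightDividesˡ y y′)

    -- `Γ` supplies `η` values of x with one point above each, and `𝒮-fibre` enlarges every such
    -- point to a full fibre.
    Γ-points : ∀ {η γ} → Γ η γ → Σ[ xs ∈ Vector Carrier η ] Σ[ bs ∈ Vector Carrier η ]
      (Distinct xs × (∀ (s : Fin η) (δ : Fin p) → T η (xs s ∷ bs s + toℕ δ · 1# ∷ γ ∷ [])))
    Γ-points {η} {γ} γ∈Γ@(_ , m , size , η≤m) =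
      (λ s → proj₁ (to (inject≤ s η≤m))) ,
      (λ s → proj₁ (point s)) ,
      (λ eq → Fin.inject≤-injective η≤m η≤m _ _ (injective eq)) ,
      (λ s δ → 𝒮-fibre (toℕ δ) (proj₂ (point s)) , γ∈Γ)
      where
      open Bijection size using (to; injective)
      point : ∀ s → ∃[ b ] 𝒮 (proj₁ (to (inject≤ s η≤m)) ∷ b ∷ γ ∷ [])
      point s with to (inject≤ s η≤m)
      ... | x , Q@(_ ∷ b ∷ _ ∷ []) , Q∈𝒵 , a≈x with 𝒵⁻ Q Q∈𝒵
      ...   | Q∈𝒮 , z≈γ = b , 𝒮-cong _ (x ∷ b ∷ γ ∷ []) (a≈x ∷ refl ∷ z≈γ ∷ []) Q∈𝒮

  -- The code and its puncturings

  module HierarchicalCode {p} (pPrime : Prime p) (p·1≈0 : p · 1# ≈ 0#) (f : Polynomial 2)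
    (η l m o n : ℕ) (l<η : l ℕ.< η) (m<p : m ℕ.< p)
    (ordering : HasSize (𝔸-setoid 3) (Surface.T p f η) n) where

    open Characteristic pPrime p·1≈0
    open SurfacePoints pPrime p·1≈0 f
    open Surface p f
    open BoxSpace l m o

    private
      L = l ℕ.+ 1
      M = m ℕ.+ 1
      N = o ℕ.+ 1

      +1≤ : ∀ {i j} → i ℕ.< j → i ℕ.+ 1 ≤ j
      +1≤ {i} i<j = ℕ.≤-trans (ℕ.≤-reflexive (ℕ.+-comm i 1)) i<j

    P : Vector (𝔸 3) n
    P = proj₁ ∘ Bijection.to ordering

    open Positions P

    P∈T : ∀ j → T η (P j)
    P∈T j = proj₂ (Bijection.to ordering j)

    P-injective : Injective _≡_ _≈ₐ_ P
    P-injective = Bijection.injective ordering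

    position : ∀ Q → T η Q → ∃[ j ] P j ≈ₐ Q
    position Q Q∈T = Bijection.strictlySurjective ordering (Q , Q∈T)

    C : LinearCode n
    C = evaluationCode (boxSpace l m o) P

    fibre-point : Carrier → Carrier → Carrier → Fin p → 𝔸 3
    fibre-point x b z δ = x ∷ b + toℕ δ · 1# ∷ z ∷ []

    fibre-distinct : ∀ b → Distinct (λ (δ : Fin p) → b + toℕ δ · 1#)
    fibre-distinct b eq = prime-subfield-distinct (∙-cancelˡ b _ _ eq)

    module 𝔸³ = DecSetoid (𝔸-decSetoid 3)

    -- A set I of positions, all with z = γ, containing X full fibres; on I the
    -- degree in x can be lowered from l to L′ - 1 and z can be eliminated.
    module Restriction (I : Subset n) {X} (L′ : ℕ) (γ : Carrier)
      (xs bs : Vector Carrier X) (xs-distinct : Distinct xs)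
      (grid∈T : ∀ s δ → T η (fibre-point (xs s) (bs s) γ δ))
      (grid∈I : ∀ {j} s δ → P j ≈ₐ fibre-point (xs s) (bs s) γ δ → j ∈ I)
      (L′≤L : L′ ≤ L)
      (restrict : ∀ (A : Box L M N) →
        Σ[ B ∈ Box L′ M 1 ] (∀ {j} → j ∈ I → value A (P j) ≈ value B (P j)))
      where

      R : Vector (𝔸 3) ∣ I ∣
      R = P ∘ nth I

      code : LinearCode ∣ I ∣
      code = puncture C I

      grid-position : ∀ s δ → ∃[ k ] R k ≈ₐ fibre-point (xs s) (bs s) γ δ
      grid-position s δ with position (fibre-point (xs s) (bs s) γ δ) (grid∈T s δ)
      ... | j , Pj≈ with nth-surjective I (grid∈I s δ Pj≈)
      ...   | k , ≡.refl = k , Pj≈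

      grid-position-injective : ∀ {s s′ δ δ′} →
        proj₁ (grid-position s δ) ≡ proj₁ (grid-position s′ δ′) → (s , δ) ≡ (s′ , δ′)
      grid-position-injective {s} {s′} {δ} {δ′} eq
        with 𝔸³.trans (𝔸³.sym (proj₂ (grid-position s δ)))
               (𝔸³.trans (𝔸³.reflexive (≡.cong R eq)) (proj₂ (grid-position s′ δ′)))
      ... | x≈ ∷ y≈ ∷ _ with xs-distinct x≈
      ...   | ≡.refl = ≡.cong (s ,_) (fibre-distinct (bs s) y≈)

      evaluate-restrict : ∀ {g} → InBox g →
        Σ[ B ∈ Box L′ M 1 ] (∀ k → evaluate g (R k) ≈ value B (R k))
      evaluate-restrict {g} g∈V = let B , A≈B = restrict (coefficients g) in
        B , λ k → trans (evaluate-box g∈V (R k)) (A≈B (nth-∈ I k))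

      -- With z eliminated one value of z is enough; `X` fibres of `p` points give at least as many
      -- values of x and y as the box has coefficients in each direction.
      dimension : L′ ≤ X → HasDimension code (L′ ℕ.* M ℕ.* 1)
      dimension L′≤X = monomialBasis code R L′ M 1
        (λ e → evaluations P (boxMonomial e) ,
          (boxMonomial e , boxMonomial∈ L′≤L ℕ.≤-refl (ℕ.m≤n+m 1 o) e , λ _ → refl) , λ _ → refl)
        (λ w (u , (g , g∈V , u≈g) , w≈u) → let B , g≈B = evaluate-restrict g∈V in
          B , λ k → trans (w≈u k) (trans (u≈g (nth I k)) (g≈B k)))
        (λ B B≈0 → grid⇒0 L′≤X (+1≤ m<p) ℕ.≤-refl B
          (λ (_ : Fin 1) → γ) (λ _ → xs) (λ _ s δ → bs s + toℕ δ · 1#)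
          (singleton-distinct γ) (λ _ → xs-distinct) (λ _ s → fibre-distinct (bs s))
          (λ _ s δ → trans (sym (value-cong-point B (proj₂ (grid-position s δ)))) (B≈0 _)))

      -- The distance is the weight of the difference, which again comes from an element of the
      -- span. `grid-weight` finds enough non-zeros, and distinct grid points sit at distinct
      -- positions.
      minimumDistance : ∀ r₁ r₂ → r₁ ℕ.+ L′ ≤ ℕ.suc X → r₂ ℕ.+ M ≤ ℕ.suc p →
                        MinimumDistanceAtLeast code (r₁ ℕ.* r₂)
      minimumDistance r₁ r₂ r₁+L′≤1+X r₂+M≤1+p u v
        (u′ , (g , g∈V , u′≈g) , u≈u′) (v′ , (h , h∈V , v′≈h) , v≈v′) u≉v
        with B , d≈B ← evaluate-restrict (⊖-closed g∈V h∈V)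
        with k , uₖ≉vₖ ← Fin.¬∀⟶∃¬ ∣ I ∣ _ (λ k → u k ≟ v k) u≉v
        = conclusion
        where
        u-v≈B : ∀ k → u k - v k ≈ value B (R k)
        u-v≈B k = begin
          u k - v k
            ≈⟨ +-cong (trans (u≈u′ k) (u′≈g (nth I k)))
                 (-‿cong (trans (v≈v′ k) (v′≈h (nth I k)))) ⟩
          evaluate g (R k) - evaluate h (R k)
            ≈⟨ evaluate-⊖ g h (R k) ⟨
          evaluate (g ⊖ h) (R k)
            ≈⟨ d≈B k ⟩
          value B (R k) ∎
        conclusion : r₁ ℕ.* r₂ ≤ distance u v
        conclusion with grid-weight r₁ r₂ r₁+L′≤1+X r₂+M≤1+p B xs (λ s δ → bs s + toℕ δ · 1#) γ
          xs-distinct (λ s → fibre-distinct (bs s))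
          (R k , λ B≈0 → uₖ≉vₖ (x∙y⁻¹≈ε⇒x≈y _ _ (trans (u-v≈B k) B≈0)))
        ... | φ , φ-injective , B[φ]≉0 = injection⇒≤∣∣ (decSubset (λ k → ¬? (u k ≟ v k)))
          (λ r → proj₁ (grid-position (proj₁ (φ r)) (proj₂ (φ r))))
          (λ eq → φ-injective (grid-position-injective eq))
          (λ r → ∈-decSubset⁺ (λ k → ¬? (u k ≟ v k)) λ u≈v → B[φ]≉0 r (trans
            (sym (value-cong-point B (proj₂ (grid-position (proj₁ (φ r)) (proj₂ (φ r))))))
            (trans (sym (u-v≈B _)) (x≈y⇒x∙y⁻¹≈ε u≈v))))

    lower? : ∀ i j → Dec (πxz (P j) ≈ₐ πxz (P i))
    lower? i j = DecSetoid._≟_ (𝔸-decSetoid 2) (πxz (P j)) (πxz (P i))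

    middle? : ∀ i j → Dec (πz (P j) ≈ πz (P i))
    middle? i j = πz (P j) ≟ πz (P i)

    πxz⇒πz : ∀ Q R → πxz Q ≈ₐ πxz R → πz Q ≈ πz R
    πxz⇒πz (_ ∷ _ ∷ _ ∷ []) (_ ∷ _ ∷ _ ∷ []) (_ ∷ z≈ ∷ []) = z≈

    πxz-cong : ∀ Q R → Q ≈ₐ R → πxz Q ≈ₐ πxz R
    πxz-cong (_ ∷ _ ∷ _ ∷ []) (_ ∷ _ ∷ _ ∷ []) (x≈ ∷ _ ∷ z≈ ∷ []) = x≈ ∷ z≈ ∷ []

    lower⊆middle : ∀ i → lower i ⊆ middle i
    lower⊆middle i {j} j∈ = ∈-decSubset⁺ (middle? i)
      (πxz⇒πz (P j) (P i) (∈-decSubset⁻ (lower? i) j∈))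

    value-restrict-z : ∀ (A : Box L M N) {γ} Q → πz Q ≈ γ →
      value A Q ≈ value {N = 1} (λ i j _ → poly (A i j) γ) Q
    value-restrict-z A {γ} (x ∷ y ∷ z ∷ []) z≈γ =
      poly-cong {M} (λ j → poly-cong {L} (λ i → trans (poly-cong {N} (λ k → refl) z≈γ)
        (sym (poly-1 (λ _ → poly (A i j) γ) z))) refl) refl

    -- Freezing x and z leaves a polynomial in y alone, hence a Reed-Solomon codeword on the fibre.
    value-restrict-xz : ∀ (A : Box L M N) {a γ} Q → πxz Q ≈ₐ (a ∷ γ ∷ []) →
      value A Q ≈ value {1} {N = 1} (λ _ j _ → poly (λ i → poly (A i j) γ) a) Q
    value-restrict-xz A {a} {γ} (x ∷ y ∷ z ∷ []) (x≈a ∷ z≈γ ∷ []) =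
      poly-cong {M} (λ j → trans
        (poly-cong {L} (λ i → poly-cong {N} (λ k → refl) z≈γ) x≈a)
        (sym (trans (poly-1 (λ _ → poly {1} (λ _ → B j) z) x) (poly-1 (λ _ → B j) z)))) refl
      where
      B : Vector Carrier M
      B j = poly (λ i → poly (A i j) γ) a

    module AtPosition (i : Fin n) a b γ (Pᵢ≡ : P i ≡ a ∷ b ∷ γ ∷ []) where

      Pᵢ∈T : T η (a ∷ b ∷ γ ∷ [])
      Pᵢ∈T = ≡.subst (T η) Pᵢ≡ (P∈T i)

      fibre∈T : ∀ δ → T η (fibre-point a b γ δ)
      fibre∈T δ = 𝒮-fibre (toℕ δ) (proj₁ Pᵢ∈T) , proj₂ Pᵢ∈T

      ∈lower⁻ : ∀ {j} → j ∈ lower i → πxz (P j) ≈ₐ (a ∷ γ ∷ [])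
      ∈lower⁻ {j} j∈ = ≡.subst (λ Q → πxz (P j) ≈ₐ πxz Q) Pᵢ≡ (∈-decSubset⁻ (lower? i) j∈)

      ∈lower⁺ : ∀ {j} → πxz (P j) ≈ₐ (a ∷ γ ∷ []) → j ∈ lower i
      ∈lower⁺ {j} eq = ∈-decSubset⁺ (lower? i) (≡.subst (λ Q → πxz (P j) ≈ₐ πxz Q) (≡.sym Pᵢ≡) eq)

      ∈middle⁻ : ∀ {j} → j ∈ middle i → πz (P j) ≈ γ
      ∈middle⁻ {j} j∈ = ≡.subst (λ Q → πz (P j) ≈ πz Q) Pᵢ≡ (∈-decSubset⁻ (middle? i) j∈)

      ∈middle⁺ : ∀ {j} → πz (P j) ≈ γ → j ∈ middle i
      ∈middle⁺ {j} eq = ∈-decSubset⁺ (middle? i) (≡.subst (λ Q → πz (P j) ≈ πz Q) (≡.sym Pᵢ≡) eq)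

      fibre⊆lower : ∀ {j} δ → P j ≈ₐ fibre-point a b γ δ → j ∈ lower i
      fibre⊆lower {j} δ eq = ∈lower⁺ (πxz-cong (P j) (fibre-point a b γ δ) eq)

      lower⊆fibre : ∀ {j} → j ∈ lower i → ∃[ δ ] P j ≈ₐ fibre-point a b γ δ
      lower⊆fibre {j} j∈ = go (P j) (proj₁ (P∈T j)) (∈lower⁻ j∈)
        where
        go : ∀ Q → 𝒮 Q → πxz Q ≈ₐ (a ∷ γ ∷ []) → ∃[ δ ] Q ≈ₐ fibre-point a b γ δ
        go Q@(x ∷ y ∷ z ∷ []) Q∈𝒮 (x≈a ∷ z≈γ ∷ [])
          with δ , y≈ ← 𝒮-fibre-complete (proj₁ Pᵢ∈T)
                          (𝒮-cong Q (a ∷ y ∷ γ ∷ []) (x≈a ∷ refl ∷ z≈γ ∷ []) Q∈𝒮)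
          = δ , x≈a ∷ y≈ ∷ z≈γ ∷ []

      -- Positions inject into shifts, as every point over `(a, γ)` is a shift of the given one;
      -- shifts inject into positions, as all shifts lie in `T`.
      ∣lower∣≡p : ∣ lower i ∣ ≡ p
      ∣lower∣≡p = ℕ.≤-antisym
        (Fin.injective⇒≤ {f = λ k → proj₁ (shift k)} λ {k} {k′} eq →
          nth-injective (lower i) (P-injective (𝔸³.trans (proj₂ (shift k))
            (𝔸³.trans (𝔸³.reflexive (≡.cong (fibre-point a b γ) eq))
              (𝔸³.sym (proj₂ (shift k′)))))))
        (injection⇒≤∣∣ (lower i) (λ δ → proj₁ (at δ))
          (λ {δ} {δ′} eq → distinct (𝔸³.trans (𝔸³.sym (proj₂ (at δ)))
            (𝔸³.trans (𝔸³.reflexive (≡.cong P eq)) (proj₂ (at δ′)))))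
          (λ δ → fibre⊆lower δ (proj₂ (at δ))))
        where
        shift : ∀ k → ∃[ δ ] P (nth (lower i) k) ≈ₐ fibre-point a b γ δ
        shift k = lower⊆fibre (nth-∈ (lower i) k)
        at : ∀ δ → ∃[ j ] P j ≈ₐ fibre-point a b γ δ
        at δ = position (fibre-point a b γ δ) (fibre∈T δ)
        distinct : ∀ {δ δ′} → fibre-point a b γ δ ≈ₐ fibre-point a b γ δ′ → δ ≡ δ′
        distinct (_ ∷ y≈ ∷ _) = fibre-distinct b y≈

      middle⇔𝒵 : ∀ Q → 𝒵 γ Q ⇔ (∃[ j ] (j ∈ middle i × P j ≈ₐ Q))
      middle⇔𝒵 Q = mk⇔ to from
        where
        πz-cong : ∀ Q R → Q ≈ₐ R → πz Q ≈ πz R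
        πz-cong Q R Q≈R = πxz⇒πz Q R (πxz-cong Q R Q≈R)
        to : 𝒵 γ Q → ∃[ j ] (j ∈ middle i × P j ≈ₐ Q)
        to Q∈𝒵 =
          let Q∈𝒮 , z≈γ = 𝒵⁻ Q Q∈𝒵
              j , Pj≈Q = position Q (Q∈𝒮 , Γ-cong (sym z≈γ) (proj₂ Pᵢ∈T))
          in j , ∈middle⁺ (trans (πz-cong (P j) Q Pj≈Q) z≈γ) , Pj≈Q
        from : ∃[ j ] (j ∈ middle i × P j ≈ₐ Q) → 𝒵 γ Q
        from (j , j∈ , Pj≈Q) = 𝒵⁺ Q (𝒮-cong (P j) Q Pj≈Q (proj₁ (P∈T j)))
          (trans (sym (πz-cong (P j) Q Pj≈Q)) (∈middle⁻ j∈))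

      -- One fibre: x takes a single value, so a single coefficient in x is left.
      module Lower = Restriction (lower i) 1 γ (λ (_ : Fin 1) → a) (λ _ → b)
        (singleton-distinct a) (λ _ → fibre∈T) (λ _ → fibre⊆lower) (ℕ.m≤n+m 1 l)
        (λ A → _ , λ {j} j∈ → value-restrict-xz A (P j) (∈lower⁻ j∈))

      middle-points : Σ[ xs ∈ Vector Carrier η ] Σ[ bs ∈ Vector Carrier η ]
        (Distinct xs × (∀ s δ → T η (fibre-point (xs s) (bs s) γ δ)))
      middle-points = Γ-points (proj₂ Pᵢ∈T)

      grid⊆middle : ∀ {j} x y δ → P j ≈ₐ fibre-point x y γ δ → j ∈ middle i
      grid⊆middle {j} x y δ eq = ∈middle⁺
        (πxz⇒πz (P j) (fibre-point x y γ δ) (πxz-cong (P j) (fibre-point x y γ δ) eq))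

      -- `η` fibres, with all exponents of x kept.
      module Middle = Restriction (middle i) L γ (proj₁ middle-points) (proj₁ (proj₂ middle-points))
        (proj₁ (proj₂ (proj₂ middle-points))) (proj₂ (proj₂ (proj₂ middle-points)))
        (λ s → grid⊆middle _ _) ℕ.≤-refl
        (λ A → _ , λ {j} j∈ → value-restrict-z A (P j) (∈middle⁻ j∈))

    module _ (zs : Vector Carrier N) (zs-distinct : Distinct zs) (zs∈Γ : ∀ t → Γ η (zs t)) where

      -- The `N` values in `zs` supply the roots in z, and each carries `η` full fibres for the
      -- roots in x and y.
      value≈0⇒≈0 : (A : Box L M N) → (∀ k → value A (P k) ≈ 0#) → ∀ i j k → A i j k ≈ 0#
      value≈0⇒≈0 A A≈0 = grid⇒0 (+1≤ l<η) (+1≤ m<p) ℕ.≤-refl A zs xs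
        (λ t s δ → bs t s + toℕ δ · 1#) zs-distinct (λ t → proj₁ (proj₂ (proj₂ (points t))))
        (λ t s → fibre-distinct (bs t s)) (λ t s δ →
          let k , Pk≈ = position (fibre-point (xs t s) (bs t s) (zs t) δ)
                          (proj₂ (proj₂ (proj₂ (points t))) s δ)
          in trans (sym (value-cong-point A Pk≈)) (A≈0 k))
        where
        points : ∀ t → _
        points t = Γ-points (zs∈Γ t)
        xs bs : Fin N → Vector Carrier η
        xs t = proj₁ (points t)
        bs t = proj₁ (proj₂ (points t))

      evaluation-injective : ∀ g h → InBox g → InBox h →
        (∀ k → evaluations P g k ≈ evaluations P h k) → g ≈ₚ h
      evaluation-injective g h g∈V h∈V g≈h e = x∙y⁻¹≈ε⇒x≈y _ _ (trans (sym (coefficient-⊖ g h e))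
        (coefficients≈0⇒≈0 d∈V (value≈0⇒≈0 (coefficients (g ⊖ h)) λ k →
          trans (sym (evaluate-box d∈V (P k)))
            (trans (evaluate-⊖ g h (P k)) (x≈y⇒x∙y⁻¹≈ε (g≈h k)))) e))
        where d∈V = ⊖-closed g∈V h∈V

      dimension : HasDimension C (L ℕ.* M ℕ.* N)
      dimension = monomialBasis C P L M N
        (λ e → boxMonomial e , boxMonomial∈ ℕ.≤-refl ℕ.≤-refl ℕ.≤-refl e , λ _ → refl)
        (λ w (g , g∈V , w≈g) → coefficients g , λ k → trans (w≈g k) (evaluate-box g∈V (P k)))
        value≈0⇒≈0

theorem3p1 :
  ∀ {c ℓ} (p h : ℕ) → Prime p → ¬ 2 ∣ p → 1 ≤ h →
  (𝔽 : FiniteField c ℓ (p ℕ.^ h)) →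
  let open OverField 𝔽 in
  (f : Polynomial 2) →
  let open Surface p f in
  (η : ℕ) → 1 ≤ η →
  (ν ρ₁ ρ₂ ρ₃ : ℕ) →
  (∀ γ → Γ η γ → ∃[ d ] (HasDegree (planeEquation γ) d × d ≤ ν)) →
  2 ≤ ρ₁ → ρ₁ ≤ η → 2 ≤ ρ₂ → ρ₂ ≤ p → ρ₃ ≤ p ℕ.^ 2 ∸ 1 →
  SizeAtLeast setoid
    (λ γ → Γ η γ × SizeAtLeast (𝔸-setoid 3) (𝒵 γ) (ν ℕ.* ((η ∸ ρ₁) ℕ.+ (p ∸ ρ₂)) ℕ.+ 1))
    (ρ₃ ℕ.+ 1) →
  (n : ℕ) (ordering : HasSize (𝔸-setoid 3) (T η) n) →
  let P : Vector (𝔸 3) n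
      P = proj₁ ∘ Bijection.to ordering
      V = boxSpace (η ∸ ρ₁) (p ∸ ρ₂) ρ₃
      C = evaluationCode V P
      open Positions P
  in
  (∀ (i : Fin n) a b c′ → P i ≡ a ∷ b ∷ c′ ∷ [] →
    (∣ lower i ∣ ≡ p
      × (∀ (δ : Fin p) → T η (a ∷ b + toℕ δ · 1# ∷ c′ ∷ []))
      × (∀ j → j ∈ lower i ⇔ (∃[ δ ] P j ≈ₐ a ∷ b + toℕ {p} δ · 1# ∷ c′ ∷ []))
      × DimensionAtMost (puncture C (lower i)) (p ∸ ρ₂ ℕ.+ 1)
      × MinimumDistanceAtLeast (puncture C (lower i)) ρ₂)
    ×
    ((∀ Q → 𝒵 c′ Q ⇔ (∃[ j ] (j ∈ middle i × P j ≈ₐ Q)))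
      × DimensionAtMost (puncture C (middle i)) ((η ∸ ρ₁ ℕ.+ 1) ℕ.* (p ∸ ρ₂ ℕ.+ 1))
      × MinimumDistanceAtLeast (puncture C (middle i)) (ρ₁ ℕ.* ρ₂)
      × lower i ⊆ middle i))
  × (∀ g g′ → Subspace.Member V g → Subspace.Member V g′ →
       (∀ k → evaluations P g k ≈ evaluations P g′ k) → g ≈ₚ g′)
  × HasDimension C ((η ∸ ρ₁ ℕ.+ 1) ℕ.* (p ∸ ρ₂ ℕ.+ 1) ℕ.* (ρ₃ ℕ.+ 1))
theorem3p1 p h pPrime _ _ 𝔽 f η _ ν ρ₁ ρ₂ ρ₃ _ 2≤ρ₁ ρ₁≤η 2≤ρ₂ ρ₂≤p _ (_ , size , ρ₃+1≤) n ordering =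
  (λ i a b γ Pᵢ≡ → let open AtPosition i a b γ Pᵢ≡ in
    ( ∣lower∣≡p
    , fibre∈T
    , (λ j → mk⇔ lower⊆fibre (λ (δ , eq) → fibre⊆lower δ eq))
    -- The bound is attained: the box has sides 1, `p ∸ ρ₂ + 1` and 1.
    , (_ , Lower.dimension ℕ.≤-refl ,
       ℕ.≤-reflexive (≡.trans (ℕ.*-identityʳ _) (ℕ.*-identityˡ (p ∸ ρ₂ ℕ.+ 1))))
    , ≡.subst (MinimumDistanceAtLeast Lower.code) (ℕ.*-identityˡ ρ₂)
        (Lower.minimumDistance 1 ρ₂ ℕ.≤-refl (ρ+[n∸ρ+1]≤1+n ρ₂≤p)))
    , ( middle⇔𝒵
      , (_ , Middle.dimension (ℕ.≤-trans (ℕ.≤-reflexive (ℕ.+-comm (η ∸ ρ₁) 1)) l<η) ,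
         ℕ.≤-reflexive (ℕ.*-identityʳ _))
      , Middle.minimumDistance ρ₁ ρ₂ (ρ+[n∸ρ+1]≤1+n ρ₁≤η) (ρ+[n∸ρ+1]≤1+n ρ₂≤p)
      , lower⊆middle i))
  , evaluation-injective zs zs-distinct zs∈Γ
  , dimension zs zs-distinct zs∈Γ
  where
  open OverField 𝔽
  open OverFiniteField 𝔽
  open Surface p f using (Γ)

  -- The count required by `nonroots`, met with equality: `n` points and degree `n ∸ ρ` leave `ρ`
  -- non-roots.
  ρ+[n∸ρ+1]≤1+n : ∀ {ρ n} → ρ ≤ n → ρ ℕ.+ (n ∸ ρ ℕ.+ 1) ≤ ℕ.suc n
  ρ+[n∸ρ+1]≤1+n {ρ} {n} ρ≤n = ℕ.≤-reflexive (≡.trans (≡.sym (ℕ.+-assoc ρ (n ∸ ρ) 1))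
    (≡.trans (≡.cong (ℕ._+ 1) (ℕ.m+[n∸m]≡n ρ≤n)) (ℕ.+-comm n 1)))

  n∸ρ<n : ∀ {ρ n} → 2 ≤ ρ → ρ ≤ n → n ∸ ρ ℕ.< n
  n∸ρ<n 2≤ρ ρ≤n = ℕ.∸-monoʳ-< (ℕ.≤-trans (ℕ.s≤s ℕ.z≤n) 2≤ρ) ρ≤n

  l<η : η ∸ ρ₁ ℕ.< η
  l<η = n∸ρ<n 2≤ρ₁ ρ₁≤η

  open HierarchicalCode pPrime (^·1≈0⇒·1≈0 p h q·1≈0) f η (η ∸ ρ₁) (p ∸ ρ₂) ρ₃ n
    l<η (n∸ρ<n 2≤ρ₂ ρ₂≤p) ordering

  -- The first `ρ₃ + 1` entries of the listing provided by assumption (3).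
  zs : Vector Carrier (ρ₃ ℕ.+ 1)
  zs t = proj₁ (Bijection.to size (inject≤ t ρ₃+1≤))

  zs-distinct : Distinct zs
  zs-distinct eq = Fin.inject≤-injective ρ₃+1≤ ρ₃+1≤ _ _ (Bijection.injective size eq)

  zs∈Γ : ∀ t → Γ η (zs t)
  zs∈Γ t = proj₁ (proj₂ (Bijection.to size (inject≤ t ρ₃+1≤)))
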